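{- Let $k=k(N)$ be a function of the number $N$ of variables of a formula, with $k=o(N)$ and $k\ge\log N$. Then $2k$-SR-I is exponentially separated from $(2k-1)$-SRC-II.
   Context: $\log$ is the binary logarithm. A proof system $A$ is exponentially separated from a proof system $B$ if there exists a family of unsatisfiable CNF formulas $\Phi_n$ such that $S_A(\Phi_n)=\mathcal{O}(\mathrm{poly}(n))$ and $S_B(\Phi_n)=2^{\Omega(n)}$, where $S_\Pi(\Phi)$ is the number of steps in the shortest proof of $\Phi$ in $\Pi$. When the symmetry bound is a function of $N$, it is evaluated at the number of variables of the formula being refuted. A clause is a disjunction (set) of literals. For $k\ge1$ (a constant or a function), a $k$-symmetry is a bijection $\phi$ of literals onto literals with $\phi(\lnot x)=\lnot\phi(x)$ and $\phi(x)=x$ for all variables $x$ except at most $k$ of them; it acts on clauses literal by literal. It is positive if it maps variables to variables (without negation). A $k$-SRC-II proof (Resolution with local $k$-symmetries) of an unsatisfiable CNF is a sequence of clauses ending with the empty clause, each of which is an input clause, or is obtained from earlier clauses by the resolution rule (from $A\lor x$ and $B\lor\lnot x$ infer $A\lor B$), or is obtained by the symmetry rule: if a clause $A$ was inferred earlier in the proof from $B_1,\dots,B_l$, and $\phi$ is a $k$-symmetry such that all $B_i$ and all $\phi(B_i)$ are input clauses, infer $\phi(A)$ in one step. In $k$-SR-I (global positive $k$-symmetries) the symmetry rule requires instead that both sets $\{B_i\}$ and $\{\phi(B_i)\}$ be equal to the set of all input clauses and that $\phi$ be positive. There is no weakening rule. -}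

module Defs where

open import Data.Bool using (Bool; true; false; not)
import Data.Bool.Properties as Bool
open import Data.Fin using (Fin)
import Data.Fin.Properties as Fin
open import Data.List using (List; []; _∷_; [_]; _++_; map; filter; length; allFin)
open import Data.List.Membership.Propositional using (_∈_)
import Data.List.Membership.Setoid as SetoidMembership
import Data.List.Relation.Binary.Subset.Setoid as SetoidSubset
open import Data.List.Relation.Binary.BagAndSetEquality using ([_]-Equality; set)
open import Data.List.Relation.Unary.All using (All)
open import Data.List.Relation.Unary.Any using (Any)
open import Data.Nat using (ℕ; suc; _*_; _^_; _≤_)
open import Data.Product using (Σ-syntax; ∃-syntax; _×_; _,_; proj₁; map₂)
import Data.Product.Properties as Product
open import Function.Bundles using (_↔_; Inverse)
open import Relation.Binary.Bundles using (Setoid)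
open import Relation.Binary.Definitions using (DecidableEquality)
open import Relation.Binary.PropositionalEquality using (_≡_)
open import Relation.Nullary using (¬_)
open import Relation.Nullary.Decidable using (¬?)

------------------------------------------------------------------------
-- Clauses and CNF formulas

Literal : ℕ → Set
Literal n = Fin n × Bool

pattern pos x = x , true
pattern neg x = x , false

negate : ∀ {n} → Literal n → Literal n
negate = map₂ not

_≟_ : ∀ {n} → DecidableEquality (Literal n)
_≟_ = Product.≡-dec Fin._≟_ Bool._≟_

-- Lists stand for the finite sets of their members: clauses are compared
-- by set equality only, and sets of clauses by mutual inclusion modulo
-- that equality.
Clause : ℕ → Set
Clause n = List (Literal n)

clauseSetoid : ℕ → Setoid _ _
clauseSetoid n = [ set ]-Equality (Literal n)

module _ {n : ℕ} where
  open SetoidMembership (clauseSetoid n) public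
    using () renaming (_∈_ to _∈ᶜ_)
  open SetoidSubset (clauseSetoid n) public
    using () renaming (_⊆_ to _⊆ᶜ_)

infix 4 _≐ᶜ_

_≐ᶜ_ : ∀ {n} → List (Clause n) → List (Clause n) → Set
S ≐ᶜ T = S ⊆ᶜ T × T ⊆ᶜ S

-- Every variable has to occur, so that `vars` really is the number of
-- variables of the formula and cannot be inflated.
record CNF : Set where
  field
    vars    : ℕ
    clauses : List (Clause vars)
    occurs  : ∀ x → Any (λ C → x ∈ map proj₁ C) clauses

open CNF public

Unsatisfiable : CNF → Set
Unsatisfiable Φ =
  ¬ (Σ[ σ ∈ (Fin (vars Φ) → Bool) ]
       All (Any (λ (x , b) → σ x ≡ b)) (clauses Φ))

------------------------------------------------------------------------
-- Symmetries

record Symmetry (n : ℕ) : Set where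
  field
    bijection : Literal n ↔ Literal n

  act : Literal n → Literal n
  act = Inverse.to bijection

  field
    act-negate : ∀ ℓ → act (negate ℓ) ≡ negate (act ℓ)

  actᶜ : Clause n → Clause n
  actᶜ = map act

  moved : List (Fin n)
  moved = filter (λ x → ¬? (act (pos x) ≟ pos x)) (allFin n)

open Symmetry public

IsSymmetry : ∀ {n} → ℕ → Symmetry n → Set
IsSymmetry k φ = length (moved φ) ≤ k

Positive : ∀ {n} → Symmetry n → Set
Positive φ = ∀ x → ∃[ y ] act φ (pos x) ≡ pos y

------------------------------------------------------------------------
-- Resolution with a symmetry rule

-- A clause together with the input clauses it was inferred from.
Line : ℕ → Set
Line n = List (Clause n) × Clause n

infixl 6 _─_

_─_ : ∀ {n} → Clause n → Literal n → Clause n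
C ─ ℓ = filter (λ ℓ′ → ¬? (ℓ′ ≟ ℓ)) C

-- `R F φ B` is the side condition for applying φ to a clause inferred
-- from the set B of input clauses of the formula with clause set F.
SymmetryRule : Set₁
SymmetryRule =
  ∀ {n} → List (Clause n) → Symmetry n → List (Clause n) → Set

module _ (R : SymmetryRule) {n : ℕ} (F : List (Clause n)) where

  data Justified (earlier : List (Line n)) : Line n → Set where

    input : ∀ {C} → C ∈ᶜ F → Justified earlier ([ C ] , C)

    resolution : ∀ {B₁ B₂ C D} (x : Fin n) →
      (B₁ , C) ∈ earlier → pos x ∈ C →
      (B₂ , D) ∈ earlier → neg x ∈ D →
      Justified earlier (B₁ ++ B₂ , (C ─ pos x) ++ (D ─ neg x))

    -- A clause inferred from B also counts as inferred from any B′ ⊇ B;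
    -- in particular, all clauses are inferred from the set of all input
    -- clauses.  Applying φ to the whole derivation of A shows that the
    -- conclusion is inferred from φ(B).
    symmetry : ∀ {B B′ A} (φ : Symmetry n) →
      (B , A) ∈ earlier → B ⊆ᶜ B′ → R F φ B′ →
      Justified earlier (map (actᶜ φ) B , actᶜ φ A)

  -- The most recent line comes first.
  data Derivation : List (Line n) → Set where
    []  : Derivation []
    _∷_ : ∀ {ℓ earlier} → Justified earlier ℓ → Derivation earlier →
          Derivation (ℓ ∷ earlier)

record Refutation (R : SymmetryRule) (Φ : CNF) : Set where
  field
    support    : List (Clause (vars Φ))
    earlier    : List (Line (vars Φ))
    derivation : Derivation R (clauses Φ) ((support , []) ∷ earlier)

record ProofSystem : Set₁ where
  field
    Proof : CNF → Set
    steps : ∀ {Φ} → Proof Φ → ℕ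

open ProofSystem public

resolutionWith : SymmetryRule → ProofSystem
resolutionWith R = record
  { Proof = Refutation R
  ; steps = λ π → suc (length (Refutation.earlier π))
  }

-- In both systems the bound k is evaluated at the number of variables.

SRC-II : (ℕ → ℕ) → ProofSystem
SRC-II k = resolutionWith λ {n} F φ B →
  IsSymmetry (k n) φ × B ⊆ᶜ F × map (actᶜ φ) B ⊆ᶜ F

SR-I : (ℕ → ℕ) → ProofSystem
SR-I k = resolutionWith λ {n} F φ B →
  IsSymmetry (k n) φ × Positive φ × B ≐ᶜ F × map (actᶜ φ) B ≐ᶜ F

------------------------------------------------------------------------
-- Asymptotics and exponential separation

infix 4 _∈o_

-- ε ranges over the numbers 1/(1 + c).
_∈o_ : (ℕ → ℕ) → (ℕ → ℕ) → Set
f ∈o g = ∀ c → ∃[ N₀ ] (∀ N → N₀ ≤ N → suc c * f N ≤ g N)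

-- The shortest A-proof of Φ n has at most c * n ^ d steps.
PolynomialSize : ProofSystem → (ℕ → CNF) → Set
PolynomialSize A Φ =
  ∃[ c ] ∃[ d ] ∃[ n₀ ] (∀ n → n₀ ≤ n →
    Σ[ π ∈ Proof A (Φ n) ] steps A π ≤ c * n ^ d)

-- Every B-proof π of Φ n has at least 2 ^ (n / (1 + d)) steps; the
-- inequality is raised to the power 1 + d to stay within ℕ.
ExponentialSize : ProofSystem → (ℕ → CNF) → Set
ExponentialSize B Φ =
  ∃[ d ] ∃[ n₀ ] (∀ n → n₀ ≤ n →
    (π : Proof B (Φ n)) → 2 ^ n ≤ steps B π ^ suc d)

ExponentiallySeparatedFrom : ProofSystem → ProofSystem → Set
ExponentiallySeparatedFrom A B =
  Σ[ Φ ∈ (ℕ → CNF) ]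
    (∀ n → Unsatisfiable (Φ n)) × PolynomialSize A Φ × ExponentialSize B Φ

-- Take a binary linear code of length n + m with codewords indexed by the words
-- a of length n, whose generators have weight exactly k and whose nonzero
-- codewords have weight at least k.  Code positions carry two variables each,
-- and the leaf clause of a contains, for every position, the variable selected
-- by the codeword of a.  Together with ¬x ∨ ¬y for the two variables of the n
-- information positions and ¬v for both variables of the others, the leaves
-- form an unsatisfiable formula in which no leaf is redundant.
--
-- Adding a generator to all codewords is a positive symmetry that moves 2k
-- variables, and n of those reduce the 2^n leaves to a single one.
-- Conversely a symmetry taking a leaf to a different one moves every variable
-- in their symmetric difference, hence at least 2k variables; so smaller
-- symmetries produce no leaf that was not an input line of the proof, and all
-- 2^n leaves are needed.
--
-- The formula is built with N = 256 n² variables.  If k = k(N) is at most about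
-- N / 2n, every information bit is repeated k times.  Otherwise k ≥ 64 n, and
-- a derandomised choice of 3k sparse random columns gives generators of weight
-- below k and sums of several generators of weight above k; k(N) = o(N) makes
-- room for this code.

module Submission where

open import Algebra.Bundles using (CommutativeMonoid; CommutativeRing)
open import Data.Bool using (Bool; true; false; T; not; if_then_else_; _∧_; _xor_)
import Data.Bool.Properties as Bool
open import Data.Empty using (⊥; ⊥-elim)
open import Data.Fin using (Fin; zero; suc; _↑ˡ_; _↑ʳ_; splitAt)
import Data.Fin.Properties as Fin
open import Data.List using (List; []; _∷_; [_]; _++_; map; filter; length; allFin; cartesianProductWith; concat; tabulate)
  renaming (lookup to lookupᴸ; replicate to replicateᴸ)
import Data.List.Membership.DecPropositional as DecMembership
open import Data.List.Membership.Propositional using (_∈_; lose; find)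
open import Data.List.Membership.Propositional.Properties
open import Data.List.Properties
  using (length-++; length-map; length-tabulate; map-∘; map-cong; map-id; map-tabulate; filter-++;
         tabulate-cong; tabulate-lookup)
open import Data.List.Relation.Unary.All using (All; []; _∷_)
import Data.List.Relation.Unary.All as All
open import Data.List.Relation.Unary.Any using (Any; here; there; satisfied)
import Data.List.Relation.Unary.Any as Any
import Data.List.Relation.Unary.Any.Properties as Any
open import Data.List.Relation.Unary.Unique.Propositional using (Unique; []; _∷_)
import Data.List.Relation.Unary.Unique.Propositional.Properties as Unique
open import Data.Nat
  using (ℕ; zero; suc; _+_; _*_; _^_; _∸_; _⊓_; _≤_; _<_; _<ᵇ_; NonZero; >-nonZero; z≤n; s≤s)
open import Data.Nat.ListAction using (sum)
open import Data.Nat.Logarithm using (⌈log₂_⌉; ⌈log₂⌉-mono-≤)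
open import Data.Nat.Properties hiding (_≟_)
open import Data.Nat.Tactic.RingSolver using (solve-∀)
open import Data.Product using (Σ-syntax; ∃-syntax; _×_; _,_; proj₁; proj₂)
open import Data.Product.Function.NonDependent.Propositional using (_×-↔_)
open import Data.Sum using (_⊎_; inj₁; inj₂; [_,_]′)
open import Data.Sum.Function.Propositional using (_⊎-↔_)
open import Data.Vec using (Vec; []; _∷_; lookup; replicate; zipWith)
import Data.Vec as Vec using (tabulate)
import Data.Vec.Properties as Vec
open import Function.Base using (_∘_; id)
open import Function.Bundles using (_↔_; Inverse; mk↔ₛ′; _⇔_; mk⇔)
open Function.Bundles.Equivalence using (to; from)
open import Function.Properties.Inverse using (↔-refl; ↔-trans)
open import Relation.Binary.PropositionalEquality hiding ([_])
open import Relation.Nullary using (¬_; yes; no; contradiction)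
open import Relation.Nullary.Decidable using (¬?)
open import Defs

open import Algebra.Properties.CommutativeSemigroup
  (CommutativeMonoid.commutativeSemigroup (CommutativeRing.+-commutativeMonoid Bool.xor-∧-commutativeRing))
  using (interchange)

private variable
  n : ℕ
  A : Set

-- Counting with duplicate-free lists.

unique-⊆⇒length≤ : {xs ys : List A} → Unique xs → (∀ {x} → x ∈ xs → x ∈ ys) →
                   length xs ≤ length ys
unique-⊆⇒length≤ [] _ = z≤n
unique-⊆⇒length≤ {xs = x ∷ xs} (x∉xs ∷ xs!) xs⊆ys
  -- Delete one occurrence of `x` from the larger list; by uniqueness the rest of the smaller one
  -- still fits.
  with as , bs , refl ← ∈-∃++ (xs⊆ys (here refl)) = begin
    suc (length xs)          ≤⟨ s≤s (unique-⊆⇒length≤ xs! λ y∈xs →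
                                  remove (λ { refl → All.lookup x∉xs y∈xs refl })
                                         (∈-++⁻ as (xs⊆ys (there y∈xs)))) ⟩
    suc (length (as ++ bs))  ≡⟨ cong suc (length-++ as) ⟩
    suc (length as + length bs) ≡⟨ +-suc (length as) (length bs) ⟨
    length as + length (x ∷ bs) ≡⟨ length-++ as ⟨
    length (as ++ x ∷ bs)    ∎
  where
  open ≤-Reasoning
  remove : ∀ {y} → y ≢ x → y ∈ as ⊎ y ∈ x ∷ bs → y ∈ as ++ bs
  remove y≢x (inj₁ y∈as)         = ∈-++⁺ˡ y∈as
  remove y≢x (inj₂ (here refl))  = contradiction refl y≢x
  remove y≢x (inj₂ (there y∈bs)) = ∈-++⁺ʳ as y∈bs

bools : List Bool
bools = false ∷ true ∷ []

∈-bools : ∀ b → b ∈ bools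
∈-bools false = here refl
∈-bools true  = there (here refl)

length-×bools : {B C : Set} (f : B → Bool → C) (xs : List B) →
                length (cartesianProductWith f xs bools) ≡ length xs * 2
length-×bools f []       = refl
length-×bools f (x ∷ xs) = cong (2 +_) (length-×bools f xs)

-- Words over the field with two elements

Word : ℕ → Set
Word = Vec Bool

infixl 7 _·_
infixl 6 _⊕_

_·_ : Word n → Word n → Bool
[]      · []      = false
(x ∷ a) · (y ∷ b) = (x ∧ y) xor (a · b)

_⊕_ : Word n → Word n → Word n
_⊕_ = zipWith _xor_

unit : Fin n → Word n
unit zero    = true ∷ replicate _ false
unit (suc j) = false ∷ unit j

words : ∀ n → List (Word n)
words zero    = [ [] ]
words (suc n) = map (false ∷_) (words n) ++ map (true ∷_) (words n)

∈-words : (a : Word n) → a ∈ words n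
∈-words []          = here refl
∈-words (false ∷ a) = ∈-++⁺ˡ (∈-map⁺ _ (∈-words a))
∈-words (true ∷ a)  = ∈-++⁺ʳ _ (∈-map⁺ _ (∈-words a))

length-words : ∀ n → length (words n) ≡ 2 ^ n
length-words zero    = refl
length-words (suc n) = begin
  length (map (false ∷_) ws ++ map (true ∷_) ws)
    ≡⟨ length-++ (map (false ∷_) ws) ⟩
  length (map (false ∷_) ws) + length (map (true ∷_) ws)
    ≡⟨ cong₂ _+_ (length-map _ ws) (length-map _ ws) ⟩
  length ws + length ws
    ≡⟨ cong₂ _+_ (length-words n) (trans (length-words n) (sym (+-identityʳ _))) ⟩
  2 ^ suc n ∎
  where
  open ≡-Reasoning
  ws = words n

words-unique : ∀ n → Unique (words n)
words-unique zero    = [] ∷ []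
words-unique (suc n) =
  Unique.++⁺ (Unique.map⁺ Vec.∷-injectiveʳ (words-unique n))
             (Unique.map⁺ Vec.∷-injectiveʳ (words-unique n)) disjoint
  where
  disjoint : ∀ {a} → ¬ (a ∈ map (false ∷_) (words n) × a ∈ map (true ∷_) (words n))
  disjoint (p , q) with ∈-map⁻ _ p | ∈-map⁻ _ q
  ... | _ , _ , refl | _ , _ , ()

zero-· : (a : Word n) → replicate n false · a ≡ false
zero-· []      = refl
zero-· (x ∷ a) = zero-· a

unit-· : (j : Fin n) (a : Word n) → unit j · a ≡ lookup a j
unit-· zero    (x ∷ a) = trans (cong (x xor_) (zero-· a)) (Bool.xor-identityʳ x)
unit-· (suc j) (x ∷ a) = unit-· j a

lookup-unit : (j : Fin n) → lookup (unit j) j ≡ true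
lookup-unit zero    = refl
lookup-unit (suc j) = lookup-unit j

lookup-unit⁻ : (i j : Fin n) → lookup (unit i) j ≡ true → i ≡ j
lookup-unit⁻ zero    zero    _  = refl
lookup-unit⁻ zero    (suc j) eq = contradiction (trans (sym (Vec.lookup-replicate j false)) eq) λ ()
lookup-unit⁻ (suc i) (suc j) eq = cong suc (lookup-unit⁻ i j eq)

·-comm : (a b : Word n) → a · b ≡ b · a
·-comm []      []      = refl
·-comm (x ∷ a) (y ∷ b) = cong₂ _xor_ (Bool.∧-comm x y) (·-comm a b)

-- Linearity of the code: with `c` a column, the bit at that position is additive in the message
-- word.
·-distribʳ-⊕ : (c a b : Word n) → (a ⊕ b) · c ≡ (a · c) xor (b · c)
·-distribʳ-⊕ []      []      []      = refl
·-distribʳ-⊕ (z ∷ c) (x ∷ a) (y ∷ b) =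
  trans (cong₂ _xor_ (Bool.∧-distribʳ-xor z x y) (·-distribʳ-⊕ c a b)) (interchange (x ∧ z) (y ∧ z) (a · c) (b · c))

distinct-words : {a b : Word n} → a ≢ b → ∃[ j ] lookup (a ⊕ b) j ≡ true
distinct-words {a = []} {[]} a≢b = contradiction refl a≢b
distinct-words {a = false ∷ a} {true ∷ b}  a≢b = zero , refl
distinct-words {a = true ∷ a}  {false ∷ b} a≢b = zero , refl
distinct-words {a = false ∷ a} {false ∷ b} a≢b with j , eq ← distinct-words (a≢b ∘ cong (false ∷_)) = suc j , eq
distinct-words {a = true ∷ a}  {true ∷ b}  a≢b with j , eq ← distinct-words (a≢b ∘ cong (true ∷_)) = suc j , eq

-- Clauses as sets

infix 4 _≈ᶜ_

_≈ᶜ_ : Clause n → Clause n → Set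
C ≈ᶜ D = ∀ {ℓ} → ℓ ∈ C ⇔ ℓ ∈ D

≈ᶜ-sym : {C D : Clause n} → C ≈ᶜ D → D ≈ᶜ C
≈ᶜ-sym C≈D = mk⇔ (from C≈D) (to C≈D)

≈ᶜ-trans : {C D E : Clause n} → C ≈ᶜ D → D ≈ᶜ E → C ≈ᶜ E
≈ᶜ-trans C≈D D≈E = mk⇔ (to D≈E ∘ to C≈D) (from C≈D ∘ from D≈E)

≡⇒≈ᶜ : {C D : Clause n} → C ≡ D → C ≈ᶜ D
≡⇒≈ᶜ refl = mk⇔ id id

map-⊆ : (f : Literal n → Literal n) {C D : Clause n} →
        (∀ {ℓ} → ℓ ∈ C → ℓ ∈ D) → ∀ {ℓ} → ℓ ∈ map f C → ℓ ∈ map f D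
map-⊆ f C⊆D ℓ∈ with _ , p , refl ← ∈-map⁻ f ℓ∈ = ∈-map⁺ f (C⊆D p)

map-≈ᶜ : (f : Literal n → Literal n) {C D : Clause n} → C ≈ᶜ D → map f C ≈ᶜ map f D
map-≈ᶜ f C≈D = mk⇔ (map-⊆ f (to C≈D)) (map-⊆ f (from C≈D))

∈⇒∈ᶜ : {C : Clause n} {S : List (Clause n)} → C ∈ S → C ∈ᶜ S
∈⇒∈ᶜ = Any.map λ { refl → mk⇔ id id }

map-⊆ᶜ : (φ : Symmetry n) {S T : List (Clause n)} → S ⊆ᶜ T → map (actᶜ φ) S ⊆ᶜ map (actᶜ φ) T
map-⊆ᶜ φ S⊆T C∈ with _ , D∈S , C≈φD ← find (Any.map⁻ C∈)
                with _ , E∈T , D≈E ← find (S⊆T (∈⇒∈ᶜ D∈S)) =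
  Any.map⁺ (lose E∈T (≈ᶜ-trans C≈φD (map-≈ᶜ (act φ) D≈E)))

++-⊆ᶜ : {S T U : List (Clause n)} → S ⊆ᶜ U → T ⊆ᶜ U → S ++ T ⊆ᶜ U
++-⊆ᶜ {S = S} S⊆U T⊆U C∈ = [ S⊆U , T⊆U ]′ (Any.++⁻ S C∈)

∈-─⁺ : {C : Clause n} {ℓ ℓ′ : Literal n} → ℓ ∈ C → ℓ ≢ ℓ′ → ℓ ∈ C ─ ℓ′
∈-─⁺ {ℓ′ = ℓ′} = ∈-filter⁺ (λ ℓ → ¬? (ℓ ≟ ℓ′))

∈-─⁻ : (C : Clause n) {ℓ ℓ′ : Literal n} → ℓ ∈ C ─ ℓ′ → ℓ ∈ C × ℓ ≢ ℓ′
∈-─⁻ C {ℓ′ = ℓ′} = ∈-filter⁻ (λ ℓ → ¬? (ℓ ≟ ℓ′)) {xs = C}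

open module Literals {n} = DecMembership (_≟_ {n}) using (_∈?_)

-- Soundness

eval : (Fin n → Bool) → Literal n → Bool
eval σ (x , true)  = σ x
eval σ (x , false) = not (σ x)

eval-true : (σ : Fin n → Bool) (x : Fin n) (b : Bool) → σ x ≡ b → eval σ (x , b) ≡ true
eval-true σ x true  eq = eq
eval-true σ x false eq = cong not eq

Satisfies : (Fin n → Bool) → Clause n → Set
Satisfies σ C = ∃[ ℓ ] ℓ ∈ C × eval σ ℓ ≡ true

pullback : Symmetry n → (Fin n → Bool) → Fin n → Bool
pullback φ σ x = eval σ (act φ (pos x))

eval-negate : (σ : Fin n → Bool) (ℓ : Literal n) → eval σ (negate ℓ) ≡ not (eval σ ℓ)
eval-negate σ (x , true)  = refl
eval-negate σ (x , false) = sym (Bool.not-involutive (σ x))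

eval-pullback : (φ : Symmetry n) (σ : Fin n → Bool) (ℓ : Literal n) →
                eval (pullback φ σ) ℓ ≡ eval σ (act φ ℓ)
eval-pullback φ σ (pos x) = refl
eval-pullback φ σ (neg x) =
  trans (sym (eval-negate σ (act φ (pos x)))) (cong (eval σ) (sym (act-negate φ (pos x))))


-- The sources recorded with a line already entail its clause. Hence an assignment satisfying all
-- sources of the empty clause is impossible, even if it violates some other clause of `F`.
soundness : ∀ {R : SymmetryRule} {F : List (Clause n)} {ls B C} → Derivation R F ls → (B , C) ∈ ls →
            ∀ σ → (∀ {D} → D ∈ B → Satisfies σ D) → Satisfies σ C
soundness (input _ ∷ _) (here refl) σ σ⊨B = σ⊨B (here refl)
soundness (resolution {B₁} {C = C} {D} x C∈ x∈C D∈ ¬x∈D ∷ d) (here refl) σ σ⊨B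
  with ℓ , ℓ∈C , p ← soundness d C∈ σ (σ⊨B ∘ ∈-++⁺ˡ)
     | ℓ′ , ℓ′∈D , q ← soundness d D∈ σ (σ⊨B ∘ ∈-++⁺ʳ B₁)
  with ℓ ≟ pos x | ℓ′ ≟ neg x
... | no ℓ≢x   | _        = ℓ , ∈-++⁺ˡ (∈-─⁺ ℓ∈C ℓ≢x) , p
... | yes _    | no ℓ′≢¬x = ℓ′ , ∈-++⁺ʳ (C ─ pos x) (∈-─⁺ ℓ′∈D ℓ′≢¬x) , q
... | yes refl | yes refl = contradiction (trans (sym q) (cong not p)) λ ()
-- Under the pulled-back assignment a clause has the truth value that its image has under `σ`.
soundness (symmetry φ A∈ _ _ ∷ d) (here refl) σ σ⊨φB
  with ℓ , ℓ∈A , p ← soundness d A∈ (pullback φ σ) (λ D∈B →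
         let ℓ , ℓ∈φD , q = σ⊨φB (∈-map⁺ (actᶜ φ) D∈B)
             ℓ′ , ℓ′∈D , ℓ≡φℓ′ = ∈-map⁻ (act φ) ℓ∈φD
         in ℓ′ , ℓ′∈D , trans (eval-pullback φ σ ℓ′) (trans (cong (eval σ) (sym ℓ≡φℓ′)) q))
  = act φ ℓ , ∈-map⁺ (act φ) ℓ∈A , trans (sym (eval-pullback φ σ ℓ)) p
soundness (_ ∷ d) (there ℓ∈) = soundness d ℓ∈

-- `srRule` and `srcRule` are definitionally the side conditions inside `SR-I` and `SRC-II`, named
-- so that derivations can be stated for them.
srRule : (ℕ → ℕ) → SymmetryRule
srRule K {n} F φ B = IsSymmetry (K n) φ × Positive φ × B ≐ᶜ F × map (actᶜ φ) B ≐ᶜ F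

srcRule : (ℕ → ℕ) → SymmetryRule
srcRule K {n} F φ B = IsSymmetry (K n) φ × B ⊆ᶜ F × map (actᶜ φ) B ⊆ᶜ F

-- The formula of a code

-- The code has length n + m; the bit of the codeword of a at position p is
-- a · col p.  The first n positions (the rails) spell out a itself.
module Formula {n m pad : ℕ} (col : Fin (n + m) → Word n)
               (col-rail : ∀ j → col (j ↑ˡ m) ≡ unit j) where

  Position : Set
  Position = Fin (n + m)

  positions : List Position
  positions = allFin (n + m)

  -- The padding brings the number of variables, at which the symmetry bound is evaluated, to a
  -- prescribed value.
  size : ℕ
  size = (n + m) * 2 + pad

  abstract
    decoding : Fin size ↔ ((Position × Bool) ⊎ Fin pad)
    decoding = ↔-trans Fin.+↔⊎ (↔-trans Fin.*↔× (↔-refl ×-↔ Fin.2↔Bool) ⊎-↔ ↔-refl)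

  open Inverse decoding using ()
    renaming (to to decode; from to encode; strictlyInverseˡ to decode-encode; strictlyInverseʳ to encode-decode)

  encode-injective : ∀ {u v} → encode u ≡ encode v → u ≡ v
  encode-injective {u} {v} eq = trans (sym (decode-encode u)) (trans (cong decode eq) (decode-encode v))

  var : Position → Bool → Fin size
  var p b = encode (inj₁ (p , b))

  var-injective : ∀ {p q b c} → var p b ≡ var q c → p ≡ q × b ≡ c
  var-injective {p} {q} {b} {c} eq
    with refl ← encode-injective {inj₁ (p , b)} {inj₁ (q , c)} eq = refl , refl

  -- Indices of the input clauses. An `idle` clause is a positive unit clause that only serves to
  -- make a padding variable occur.
  data Name : Set where
    leaf : Word n → Name
    rail : Fin n → Name
    aux  : Fin m → Bool → Name
    idle : Fin pad → Name

  names : List Name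
  names = map leaf (words n) ++ (map rail (allFin n) ++
          (cartesianProductWith aux (allFin m) bools ++ map idle (allFin pad)))

  ∈-names : ∀ i → i ∈ names
  ∈-names (leaf a)  = ∈-++⁺ˡ (∈-map⁺ leaf (∈-words a))
  ∈-names (rail j)  = ∈-++⁺ʳ (map leaf (words n)) (∈-++⁺ˡ (∈-map⁺ rail (∈-allFin j)))
  ∈-names (aux p b) = ∈-++⁺ʳ (map leaf (words n)) (∈-++⁺ʳ (map rail (allFin n))
    (∈-++⁺ˡ (∈-cartesianProductWith⁺ aux (∈-allFin p) (∈-bools b))))
  ∈-names (idle z)  = ∈-++⁺ʳ (map leaf (words n)) (∈-++⁺ʳ (map rail (allFin n))
    (∈-++⁺ʳ (cartesianProductWith aux (allFin m) bools) (∈-map⁺ idle (∈-allFin z))))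

  codeLiteral : Word n → Position → Literal size
  codeLiteral a p = pos (var p (a · col p))

  clause : Name → Clause size
  clause (leaf a)  = map (codeLiteral a) positions
  clause (rail j)  = neg (var (j ↑ˡ m) false) ∷ neg (var (j ↑ˡ m) true) ∷ []
  clause (aux p b) = [ neg (var (n ↑ʳ p) b) ]
  clause (idle z)  = [ pos (encode (inj₂ z)) ]

  F : List (Clause size)
  F = map clause names

  name⇒∈ᶜ : ∀ i {C} → C ≈ᶜ clause i → C ∈ᶜ F
  name⇒∈ᶜ i C≈ = Any.map⁺ (lose (∈-names i) C≈)

  ∈ᶜ⇒name : ∀ {C} → C ∈ᶜ F → ∃[ i ] C ≈ᶜ clause i
  ∈ᶜ⇒name C∈F = satisfied (Any.map⁻ C∈F)

  variable-occurs : ∀ v → ∃[ i ] encode v ∈ map proj₁ (clause i)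
  variable-occurs (inj₂ z) = idle z , here refl
  variable-occurs (inj₁ (p , b)) with splitAt n p in eq
  ... | inj₂ q rewrite sym (Fin.splitAt⁻¹-↑ʳ {n} eq) = aux q b , here refl
  ... | inj₁ j rewrite sym (Fin.splitAt⁻¹-↑ˡ {n} eq) with b
  ...   | false = rail j , here refl
  ...   | true  = rail j , there (here refl)

  Φ : CNF
  Φ = record
    { vars    = size
    ; clauses = F
    ; occurs  = λ x → let i , x∈ = variable-occurs (decode x)
                      in lose (∈-map⁺ clause (∈-names i))
                              (subst (_∈ map proj₁ (clause i)) (encode-decode x) x∈)
    }

  support : Word n → List Position
  support g = filter (λ p → g · col p Bool.≟ true) positions

  weight : Word n → ℕ
  weight g = length (support g)

  supportVars : Word n → List (Fin size)
  supportVars g = cartesianProductWith var (support g) bools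

  length-supportVars : ∀ g → length (supportVars g) ≡ weight g * 2
  length-supportVars g = length-×bools var (support g)

  ∈-supportVars : ∀ g p b → g · col p ≡ true → var p b ∈ supportVars g
  ∈-supportVars g p b eq =
    ∈-cartesianProductWith⁺ var (∈-filter⁺ (λ p → g · col p Bool.≟ true) (∈-allFin p) eq) (∈-bools b)

  -- Translation by g

  flip : Word n → (Position × Bool) ⊎ Fin pad → (Position × Bool) ⊎ Fin pad
  flip g (inj₁ (p , b)) = inj₁ (p , (g · col p) xor b)
  flip g (inj₂ z)       = inj₂ z

  flip-involutive : ∀ g v → flip g (flip g v) ≡ v
  flip-involutive g (inj₂ z) = refl
  flip-involutive g (inj₁ (p , b)) with g · col p
  ... | false = refl
  ... | true  = cong (λ c → inj₁ (p , c)) (Bool.not-involutive b)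

  translate : Word n → Literal size → Literal size
  translate g (x , s) = encode (flip g (decode x)) , s

  translate-encode : ∀ g v s → translate g (encode v , s) ≡ (encode (flip g v) , s)
  translate-encode g v s = cong (λ u → encode (flip g u) , s) (decode-encode v)

  translate-involutive : ∀ g ℓ → translate g (translate g ℓ) ≡ ℓ
  translate-involutive g (x , s) = begin
    translate g (encode (flip g (decode x)) , s)  ≡⟨ translate-encode g (flip g (decode x)) s ⟩
    (encode (flip g (flip g (decode x))) , s)     ≡⟨ cong (λ v → encode v , s) (flip-involutive g (decode x)) ⟩
    (encode (decode x) , s)                       ≡⟨ cong (_, s) (encode-decode x) ⟩
    (x , s)                                       ∎
    where open ≡-Reasoning

  translation : Word n → Symmetry size
  translation g = record
    { bijection  = mk↔ₛ′ (translate g) (translate g) (translate-involutive g) (translate-involutive g)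
    ; act-negate = λ _ → refl
    }

  translation-moves : ∀ g → length (moved (translation g)) ≤ weight g * 2
  translation-moves g = begin
    length (moved (translation g)) ≤⟨ unique-⊆⇒length≤ (Unique.filter⁺ _ (Unique.allFin⁺ size)) moved⊆ ⟩
    length (supportVars g)         ≡⟨ length-supportVars g ⟩
    weight g * 2                   ∎
    where
    open ≤-Reasoning
    support-or-fixed : ∀ v → encode (flip g v) ≢ encode v → encode v ∈ supportVars g
    support-or-fixed (inj₂ z) moves = contradiction refl moves
    support-or-fixed (inj₁ (p , b)) moves with g · col p in eq
    ... | false = contradiction refl moves
    ... | true  = ∈-supportVars g p b eq
    moved⊆ : ∀ {x} → x ∈ moved (translation g) → x ∈ supportVars g
    moved⊆ {x} x∈ with _ , moves ← ∈-filter⁻ (λ x → ¬? (translate g (pos x) ≟ pos x)) {xs = allFin size} x∈ =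
      subst (_∈ supportVars g) (encode-decode x)
        (support-or-fixed (decode x) (λ eq → moves (cong (_, true) (trans eq (encode-decode x)))))

  shift : Word n → Name → Name
  shift g (leaf a)  = leaf (g ⊕ a)
  shift g (rail j)  = rail j
  shift g (aux p b) = aux p ((g · col (n ↑ʳ p)) xor b)
  shift g (idle z)  = idle z

  -- Leaves go to leaves because codewords add. A rail clause may get its two literals exchanged, so
  -- only set equality holds.
  translate-clause : ∀ g i → map (translate g) (clause i) ≈ᶜ clause (shift g i)
  translate-clause g (leaf a) = ≡⇒≈ᶜ (trans (sym (map-∘ positions)) (map-cong translate-code positions))
    where
    translate-code : ∀ p → translate g (codeLiteral a p) ≡ codeLiteral (g ⊕ a) p
    translate-code p = trans (translate-encode g _ true)
      (cong (λ b → pos (var p b)) (sym (·-distribʳ-⊕ (col p) g a)))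
  translate-clause g (aux p b) = ≡⇒≈ᶜ (cong [_] (translate-encode g _ false))
  translate-clause g (idle z)  = ≡⇒≈ᶜ (cong [_] (translate-encode g _ true))
  translate-clause g (rail j)
    rewrite decode-encode (inj₁ (j ↑ˡ m , false)) | decode-encode (inj₁ (j ↑ˡ m , true))
    with g · col (j ↑ˡ m)
  ... | false = mk⇔ id id
  ... | true  = mk⇔ exchange exchange
    where
    exchange : ∀ {x y ℓ : Literal size} → ℓ ∈ x ∷ y ∷ [] → ℓ ∈ y ∷ x ∷ []
    exchange (here eq)         = there (here eq)
    exchange (there (here eq)) = here eq

  -- A translation permutes the names and is an involution, so mapping `F` into itself it also maps
  -- it onto itself.
  translate-F : ∀ g → map (actᶜ (translation g)) F ≐ᶜ F
  translate-F g = image⊆F , F⊆image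
    where
    image⊆F : map (map (translate g)) F ⊆ᶜ F
    image⊆F C∈ with i , C≈ ← satisfied (Any.map⁻ (Any.map⁻ C∈)) =
      name⇒∈ᶜ (shift g i) (≈ᶜ-trans C≈ (translate-clause g i))
    F⊆image : F ⊆ᶜ map (map (translate g)) F
    F⊆image C∈ with i , C≈ ← ∈ᶜ⇒name C∈ =
      Any.map⁺ (Any.map⁺ (lose (∈-names (shift g i)) (≈ᶜ-trans C≈
        (≈ᶜ-trans (≡⇒≈ᶜ (sym (double i))) (map-≈ᶜ (translate g) (translate-clause g i))))))
      where
      double : ∀ i → map (translate g) (map (translate g) (clause i)) ≡ clause i
      double i = trans (sym (map-∘ (clause i)))
                       (trans (map-cong (translate-involutive g) (clause i)) (map-id (clause i)))

  -- The short refutation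

  zeroLiteral : Position → Literal size
  zeroLiteral p = pos (var p false)

  -- Invariant of the refutation: of the zero leaf only positions in `ps` are left. It is an
  -- inclusion, so a literal that is already absent can be skipped.
  Over : List Position → Clause size → Set
  Over ps C = ∀ {ℓ} → ℓ ∈ C → ℓ ∈ map zeroLiteral ps

  module _ (K : ℕ → ℕ) (unit-weight : ∀ j → weight (unit j) * 2 ≤ K size) where

    -- `s` bounds the number of lines before the current one. The sources stay inside `F` so that
    -- the symmetry rule applies with all of `F` as the enlarged source set.
    record Reached (ps : List Position) (s : ℕ) : Set where
      field
        {earlier}  : List (Line size)
        {sources}  : List (Clause size)
        {current}  : Clause size
        derivation : Derivation (srRule K) F ((sources , current) ∷ earlier)
        sources⊆F  : sources ⊆ᶜ F
        over       : Over ps current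
        short      : length earlier ≤ s

    open Reached

    inputᵢ : ∀ {ls} i → Justified (srRule K) F ls ([ clause i ] , clause i)
    inputᵢ i = input (name⇒∈ᶜ i (mk⇔ id id))

    input⊆F : ∀ i → [ clause i ] ⊆ᶜ F
    input⊆F i (here C≈) = name⇒∈ᶜ i C≈

    over-─ : ∀ {p ps C} → Over (p ∷ ps) C → Over ps (C ─ zeroLiteral p)
    over-─ {C = C} C-over ℓ∈ with ∈-─⁻ C ℓ∈
    ... | ℓ∈C , ℓ≢ with C-over ℓ∈C
    ...   | here eq  = contradiction eq ℓ≢
    ...   | there ℓ∈ = ℓ∈

    ─-singleton : (ℓ : Literal size) {ℓ′ : Literal size} → ¬ ℓ′ ∈ [ ℓ ] ─ ℓ
    ─-singleton ℓ ℓ′∈ with ∈-─⁻ [ ℓ ] ℓ′∈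
    ... | here eq , ℓ′≢ℓ = ℓ′≢ℓ eq

    skip : ∀ {p ps s} (r : Reached (p ∷ ps) s) → ¬ zeroLiteral p ∈ current r → Reached ps s
    skip r p∉ = record
      { derivation = derivation r
      ; sources⊆F  = sources⊆F r
      ; over       = λ ℓ∈ → Any.tail (λ { refl → p∉ ℓ∈ }) (over r ℓ∈)
      ; short      = short r
      }

    weaken : ∀ {ps s t} → s ≤ t → Reached ps s → Reached ps t
    weaken s≤t r = record
      { derivation = derivation r ; sources⊆F = sources⊆F r ; over = over r ; short = ≤-trans (short r) s≤t }

    start : Reached positions 0
    start = record
      { derivation = inputᵢ (leaf (replicate n false)) ∷ []
      ; sources⊆F  = input⊆F (leaf (replicate n false))
      ; over       = subst (_ ∈_) (map-cong (λ p → cong (λ b → pos (var p b)) (zero-· (col p))) positions)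
      ; short      = z≤n
      }

    eliminate-aux : ∀ {q ps s} → Reached ((n ↑ʳ q) ∷ ps) s → Reached ps (2 + s)
    eliminate-aux {q} {ps} {s} r with zeroLiteral (n ↑ʳ q) ∈? current r
    ... | no q∉  = weaken (m≤n+m s 2) (skip r q∉)
    ... | yes q∈ = record
      { derivation = resolution (var (n ↑ʳ q) false) (there (here refl)) q∈ (here refl) (here refl)
                     ∷ inputᵢ (aux q false) ∷ derivation r
      ; sources⊆F  = ++-⊆ᶜ (sources⊆F r) (input⊆F (aux q false))
      ; over       = λ ℓ∈ → [ over-─ (over r) , (λ ℓ∈ → contradiction ℓ∈ (─-singleton (neg (var (n ↑ʳ q) false)))) ]′ (∈-++⁻ _ ℓ∈)
      ; short      = s≤s (s≤s (short r))
      }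

    translate-rail : ∀ j i → translate (unit j) (zeroLiteral (i ↑ˡ m)) ≡ pos (var (i ↑ˡ m) (lookup (unit i) j))
    translate-rail j i = trans (translate-encode (unit j) _ true)
      (cong (λ b → pos (var (i ↑ˡ m) b))
        (trans (Bool.xor-identityʳ _) (trans (cong (unit j ·_) (col-rail i)) (unit-· j (unit i)))))

    translate-rail-same : ∀ j → translate (unit j) (zeroLiteral (j ↑ˡ m)) ≡ pos (var (j ↑ˡ m) true)
    translate-rail-same j = trans (translate-rail j j) (cong (λ b → pos (var (j ↑ˡ m) b)) (lookup-unit j))

    -- From x ∨ A, translation gives y ∨ A, where x and y are the variables
    -- of the rail; both are resolved with ¬x ∨ ¬y.
    eliminate-rail : ∀ {j js s} → Reached (map (_↑ˡ m) (j ∷ js)) s → Reached (map (_↑ˡ m) js) (4 + s)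
    eliminate-rail {j} {js} {s} r with zeroLiteral (j ↑ˡ m) ∈? current r
    ... | no j∉  = weaken (m≤n+m s 4) (skip r j∉)
    ... | yes j∈ = record
      { derivation =
          resolution (var (j ↑ˡ m) true) (there (there (here refl))) y∈ (here refl) ¬y∈
          ∷ resolution (var (j ↑ˡ m) false) (there (there (here refl))) j∈ (here refl) (here refl)
          ∷ inputᵢ (rail j)
          -- The global rule wants exactly the set of all input clauses, so the sources are enlarged
          -- to `F`.
          ∷ symmetry {B′ = F} (translation (unit j)) (here refl) (sources⊆F r)
              ( ≤-trans (translation-moves (unit j)) (unit-weight j)
              , (λ x → _ , refl) , (id , id) , translate-F (unit j) )
          ∷ derivation r
      ; sources⊆F = ++-⊆ᶜ image⊆F (++-⊆ᶜ (sources⊆F r) (input⊆F (rail j)))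
      ; over      = λ ℓ∈ → [ image-over , resolvent-over ]′ (∈-++⁻ (map (translate (unit j)) (current r) ─ y) ℓ∈)
      ; short     = s≤s (s≤s (s≤s (s≤s (short r))))
      }
      where
      x y : Literal size
      x = zeroLiteral (j ↑ˡ m)
      y = pos (var (j ↑ˡ m) true)
      D : Clause size
      D = (current r ─ x) ++ (clause (rail j) ─ negate x)
      y∈ : y ∈ map (translate (unit j)) (current r)
      y∈ = subst (_∈ map (translate (unit j)) (current r)) (translate-rail-same j) (∈-map⁺ (translate (unit j)) j∈)
      ¬y∈ : negate y ∈ D
      ¬y∈ = ∈-++⁺ʳ (current r ─ x) (∈-─⁺ {C = clause (rail j)} {negate y} {negate x} (there (here refl))
        λ eq → contradiction (proj₂ (var-injective {j ↑ˡ m} {j ↑ˡ m} (cong proj₁ eq))) λ ())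
      image⊆F : map (actᶜ (translation (unit j))) (sources r) ⊆ᶜ F
      image⊆F C∈ = proj₁ (translate-F (unit j)) (map-⊆ᶜ (translation (unit j)) (sources⊆F r) C∈)
      image-over : Over (map (_↑ˡ m) js) (map (translate (unit j)) (current r) ─ y)
      image-over ℓ∈ with ∈-─⁻ (map (translate (unit j)) (current r)) ℓ∈
      ... | ℓ∈image , ℓ≢y with ∈-map⁻ (translate (unit j)) ℓ∈image
      ...   | _ , ℓ′∈ , refl with over r ℓ′∈
      ...     | here refl = contradiction (translate-rail-same j) ℓ≢y
      ...     | there ℓ′∈js with ∈-map⁻ zeroLiteral ℓ′∈js
      ...       | _ , p∈ , refl with ∈-map⁻ (_↑ˡ m) p∈
      -- Among the rails, translation by `unit j` moves only rail `j`, whose image is the literal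
      -- `y` just resolved away.
      ...         | i , i∈ , refl with lookup (unit i) j in eq | translate-rail j i
      ...           | true  | moves rewrite lookup-unit⁻ i j eq = contradiction moves ℓ≢y
      ...           | false | fixes = subst (_∈ map zeroLiteral (map (_↑ˡ m) js)) (sym fixes) ℓ′∈js
      resolvent-over : Over (map (_↑ˡ m) js) (D ─ negate y)
      resolvent-over ℓ∈ with ∈-─⁻ D ℓ∈
      ... | ℓ∈D , ℓ≢¬y with ∈-++⁻ (current r ─ x) ℓ∈D
      ...   | inj₁ ℓ∈ = over-─ (over r) ℓ∈
      ...   | inj₂ ℓ∈ with ∈-─⁻ (clause (rail j)) ℓ∈
      ...     | here eq , ℓ≢¬x         = contradiction eq ℓ≢¬x
      ...     | there (here eq) , _    = contradiction eq ℓ≢¬y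

    eliminate-auxs : ∀ qs {ps s} → Reached (map (n ↑ʳ_) qs ++ ps) s → Reached ps (length qs * 2 + s)
    eliminate-auxs []       r = r
    eliminate-auxs (q ∷ qs) {s = s} r =
      weaken (≤-reflexive (trans (+-suc (length qs * 2) (suc s)) (cong suc (+-suc (length qs * 2) s))))
             (eliminate-auxs qs (eliminate-aux r))

    eliminate-rails : ∀ js {s} → Reached (map (_↑ˡ m) js) s → Reached [] (length js * 4 + s)
    eliminate-rails []       r = r
    eliminate-rails (j ∷ js) {s} r = weaken (≤-reflexive (rearrange (length js * 4) s))
      (eliminate-rails js (eliminate-rail r))
      where
      rearrange : ∀ a b → a + (4 + b) ≡ 4 + (a + b)
      rearrange = solve-∀

    -- The auxiliary positions go first, at two lines each: the translations used later for the
    -- rails may move them. Each rail then takes four lines.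
    reached-empty : Reached [] (n * 4 + m * 2)
    reached-empty =
      weaken (≤-reflexive (cong (n * 4 +_) (+-identityʳ (m * 2))))
        (subst₂ (λ a b → Reached [] (a * 4 + (b * 2 + 0)))
                (length-tabulate {n = n} id) (length-tabulate {n = m} id)
          (eliminate-rails (allFin n) (eliminate-auxs (allFin m) (reorder start))))
      where
      reorder : ∀ {s} → Reached positions s → Reached (map (n ↑ʳ_) (allFin m) ++ map (_↑ˡ m) (allFin n)) s
      reorder r = record
        { derivation = derivation r ; sources⊆F = sources⊆F r ; short = short r
        ; over = λ ℓ∈ → map-⊆′ (over r ℓ∈) }
        where
        ∈-split : ∀ p → p ∈ map (n ↑ʳ_) (allFin m) ++ map (_↑ˡ m) (allFin n)
        ∈-split p with splitAt n p in eq
        ... | inj₁ j rewrite sym (Fin.splitAt⁻¹-↑ˡ {n} eq) = ∈-++⁺ʳ _ (∈-map⁺ _ (∈-allFin j))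
        ... | inj₂ q rewrite sym (Fin.splitAt⁻¹-↑ʳ {n} eq) = ∈-++⁺ˡ (∈-map⁺ _ (∈-allFin q))
        map-⊆′ : ∀ {ℓ} → ℓ ∈ map zeroLiteral positions → ℓ ∈ map zeroLiteral _
        map-⊆′ ℓ∈ with p , _ , refl ← ∈-map⁻ zeroLiteral ℓ∈ = ∈-map⁺ zeroLiteral (∈-split p)

    over[]⇒empty : {C : Clause size} → Over [] C → C ≡ []
    over[]⇒empty {[]}    _ = refl
    over[]⇒empty {_ ∷ _} C-over with () ← C-over (here refl)

    refutation : Σ[ π ∈ Refutation (srRule K) Φ ]
      suc (length (Refutation.earlier π)) ≤ suc (n * 4 + m * 2) × Refutation.support π ⊆ᶜ F
    refutation with reached-empty
    ... | r with over[]⇒empty (over r)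
    ...   | refl = record { derivation = derivation r } , s≤s (short r) , sources⊆F r

    satisfies-inputs : ∀ {σ S} → All (Any (λ (x , b) → σ x ≡ b)) F → S ⊆ᶜ F → ∀ {C} → C ∈ S → Satisfies σ C
    satisfies-inputs {σ} σ⊨F S⊆F C∈S with D , D∈F , C≈D ← find (S⊆F (∈⇒∈ᶜ C∈S))
                                     with (x , b) , ℓ∈D , eq ← find (All.lookup σ⊨F D∈F) =
      (x , b) , from C≈D ℓ∈D , eval-true σ x b eq

    -- By soundness of the short refutation, a model of `F` would satisfy the empty clause.
    unsatisfiable : Unsatisfiable Φ
    unsatisfiable (σ , σ⊨F) with π , _ , support⊆F ← refutation
      with () ← proj₁ (proj₂ (soundness (Refutation.derivation π) (here refl) σ (satisfies-inputs σ⊨F support⊆F)))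

  -- The lower bound

  codeLiteral∈leaf⁻ : ∀ a p b → pos (var p b) ∈ clause (leaf a) → a · col p ≡ b
  codeLiteral∈leaf⁻ a p b ℓ∈ with q , _ , eq ← ∈-map⁻ (codeLiteral a) ℓ∈
    with refl , b≡ ← var-injective {p} {q} (cong proj₁ eq) = sym b≡

  codeLiteral∈leaf⁺ : ∀ a p → codeLiteral a p ∈ clause (leaf a)
  codeLiteral∈leaf⁺ a p = ∈-map⁺ (codeLiteral a) (∈-allFin p)

  -- A literal in only one of the two leaves cannot be fixed: φ would map
  -- it out of the target, or hit it twice.
  leaf-distance : ∀ (φ : Symmetry size) a b → actᶜ φ (clause (leaf a)) ≈ᶜ clause (leaf b) →
                  weight (a ⊕ b) * 2 ≤ length (moved φ)
  leaf-distance φ a b φa≈b = begin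
    weight (a ⊕ b) * 2           ≡⟨ length-supportVars (a ⊕ b) ⟨
    length (supportVars (a ⊕ b)) ≤⟨ unique-⊆⇒length≤ supportVars-unique supportVars-moved ⟩
    length (moved φ)             ∎
    where
    open ≤-Reasoning

    supportVars-unique : Unique (supportVars (a ⊕ b))
    supportVars-unique = Unique.cartesianProductWith⁺ var (var-injective)
      (Unique.filter⁺ _ (Unique.allFin⁺ (n + m))) (((λ ()) ∷ []) ∷ [] ∷ [])

    injective : ∀ {ℓ ℓ′} → act φ ℓ ≡ act φ ℓ′ → ℓ ≡ ℓ′
    injective {ℓ} {ℓ′} eq = trans (sym (Inverse.strictlyInverseʳ (bijection φ) ℓ))
      (trans (cong (Inverse.from (bijection φ)) eq) (Inverse.strictlyInverseʳ (bijection φ) ℓ′))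

    source-moved : ∀ p → a · col p ≢ b · col p → act φ (codeLiteral a p) ≢ codeLiteral a p
    source-moved p differ fixed = differ (sym (codeLiteral∈leaf⁻ b p _
      (to φa≈b (subst (_∈ map (act φ) (clause (leaf a))) fixed (∈-map⁺ (act φ) (codeLiteral∈leaf⁺ a p))))))

    target-moved : ∀ p → a · col p ≢ b · col p → act φ (codeLiteral b p) ≢ codeLiteral b p
    target-moved p differ fixed
      with ℓ , ℓ∈a , eq ← ∈-map⁻ (act φ) (from φa≈b (codeLiteral∈leaf⁺ b p))
      with refl ← injective (trans (sym eq) (sym fixed)) = differ (codeLiteral∈leaf⁻ a p _ ℓ∈a)

    other : ∀ {x y z : Bool} → x ≢ y → z ≢ y → x ≡ z
    other x≢y z≢y = trans (Bool.¬-not x≢y) (sym (Bool.¬-not z≢y))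

    var-moved : ∀ p c → a · col p ≢ b · col p → act φ (pos (var p c)) ≢ pos (var p c)
    var-moved p c differ with c Bool.≟ a · col p
    ... | yes refl = source-moved p differ
    ... | no c≢a   rewrite other c≢a (differ ∘ sym) = target-moved p differ

    supportVars-moved : ∀ {x} → x ∈ supportVars (a ⊕ b) → x ∈ moved φ
    supportVars-moved x∈ with p , c , p∈ , _ , refl ← ∈-cartesianProductWith⁻ var (support (a ⊕ b)) bools x∈
      with _ , eq ← ∈-filter⁻ (λ p → (a ⊕ b) · col p Bool.≟ true) {xs = positions} p∈ =
      ∈-filter⁺ (λ x → ¬? (act φ (pos x) ≟ pos x)) (∈-allFin (var p c))
        (var-moved p c λ same → contradiction
          (trans (sym eq) (trans (·-distribʳ-⊕ (col p) a b) (trans (cong (_xor (b · col p)) same) (Bool.xor-same (b · col p))))) λ ())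

  -- Tells the other input clauses from the leaves, which have at least three distinct literals.
  -- Symmetries preserve the length of a list.
  Short : Clause size → Set
  Short C = length C ≤ 2

  leaf-not-short : 3 ≤ n → ∀ a {C} → Short C → C ≈ᶜ clause (leaf a) → ⊥
  leaf-not-short 3≤n a {C} C-short C≈ = contradiction (begin-strict
    2                        <⟨ 3≤n ⟩
    n                        ≤⟨ m≤m+n n m ⟩
    n + m                    ≡⟨ length-tabulate id ⟨
    length positions         ≡⟨ length-map (codeLiteral a) positions ⟨
    length (clause (leaf a)) ≤⟨ unique-⊆⇒length≤ (Unique.map⁺ codeLiteral-injective (Unique.allFin⁺ (n + m))) (from C≈) ⟩
    length C                 ≤⟨ C-short ⟩
    2                        ∎) (<-irrefl refl)
    where
    open ≤-Reasoning
    codeLiteral-injective : ∀ {p q} → codeLiteral a p ≡ codeLiteral a q → p ≡ q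
    codeLiteral-injective {p} {q} eq = proj₁ (var-injective {p} {q} (cong proj₁ eq))

  data IsLeaf : Name → Set where
    leaf : ∀ a → IsLeaf (leaf a)

  leaf-or-short : ∀ i → IsLeaf i ⊎ Short (clause i)
  leaf-or-short (leaf a)  = inj₁ (leaf a)
  leaf-or-short (rail j)  = inj₂ (s≤s (s≤s z≤n))
  leaf-or-short (aux p b) = inj₂ (s≤s z≤n)
  leaf-or-short (idle z)  = inj₂ (s≤s z≤n)

  module _ (K : ℕ → ℕ) (3≤n : 3 ≤ n) (heavy : ∀ g j → lookup g j ≡ true → K size < weight g * 2) where

    -- Otherwise `a ⊕ b` is nonzero, and by `leaf-distance` and `heavy` the symmetry would move more
    -- than `K size` variables.
    leaf-fixed : ∀ (φ : Symmetry size) a b → IsSymmetry (K size) φ →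
                 actᶜ φ (clause (leaf a)) ≈ᶜ clause (leaf b) → a ≡ b
    leaf-fixed φ a b φ-small φa≈b with Vec.≡-dec Bool._≟_ a b
    ... | yes a≡b = a≡b
    ... | no a≢b with j , eq ← distinct-words a≢b =
      contradiction (≤-trans (leaf-distance φ a b φa≈b) φ-small) (<⇒≱ (heavy (a ⊕ b) j eq))

    -- Says that `C` is an input clause other than a leaf outside `I`, where `I` will collect the
    -- leaves introduced by input lines.
    data Covered (I : List (Word n)) (C : Clause size) : Set where
      leaf  : ∀ {a} → a ∈ I → C ≈ᶜ clause (leaf a) → Covered I C
      short : ∀ {i} → Short (clause i) → C ≈ᶜ clause i → Covered I C

    covered-mono : ∀ {I J C} → (∀ {a} → a ∈ I → a ∈ J) → Covered I C → Covered J C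
    covered-mono I⊆J (leaf a∈I C≈)  = leaf (I⊆J a∈I) C≈
    covered-mono I⊆J (short {i} s C≈) = short {i = i} s C≈

    -- If the image is a leaf, its preimage is too long to be short, hence is itself a leaf, and by
    -- `leaf-fixed` the same one.
    covered-image : ∀ {I C} (φ : Symmetry size) → IsSymmetry (K size) φ → actᶜ φ C ∈ᶜ F →
                    Covered I C → Covered I (actᶜ φ C)
    covered-image φ φ-small φC∈F C-covered with ∈ᶜ⇒name φC∈F
    ... | i , φC≈ with leaf-or-short i
    ...   | inj₂ i-short = short {i = i} i-short φC≈
    ...   | inj₁ (leaf b) with C-covered
    ...     | leaf {a} a∈I C≈ = leaf (subst (_∈ _) (leaf-fixed φ a b φ-small
                (≈ᶜ-trans (map-≈ᶜ (act φ) (≈ᶜ-sym C≈)) φC≈)) a∈I) φC≈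
    ...     | short {j} s C≈  = ⊥-elim (leaf-not-short 3≤n b {map (act φ) (clause j)}
                (≤-trans (≤-reflexive (length-map (act φ) (clause j))) s)
                (≈ᶜ-trans (map-≈ᶜ (act φ) (≈ᶜ-sym C≈)) φC≈))

    covered-input : ∀ {C} → C ∈ᶜ F → ∃[ I ] length I ≤ 1 × Covered I C
    covered-input C∈F with i , C≈ ← ∈ᶜ⇒name C∈F with leaf-or-short i
    ... | inj₁ (leaf a) = [ a ] , s≤s z≤n , leaf (here refl) C≈
    ... | inj₂ i-short  = [] , z≤n , short {i = i} i-short C≈

    AllCovered : List (Word n) → List (Line size) → Set
    AllCovered I ls = ∀ {B A} → (B , A) ∈ ls → ∀ {C} → C ∈ B → Covered I C

    -- An input line contributes at most one word to `I`; resolution and symmetry lines contribute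
    -- none.
    leaves-used : ∀ {ls} → Derivation (srcRule K) F ls → ∃[ I ] length I ≤ length ls × AllCovered I ls
    leaves-used [] = [] , z≤n , λ ()
    leaves-used (input C∈F ∷ d)
      with J , J-small , J-covers ← covered-input C∈F
      with I , I-small , I-covers ← leaves-used d =
      J ++ I , subst (_≤ _) (sym (length-++ J)) (+-mono-≤ J-small I-small) , λ where
        (here refl) (here refl) → covered-mono ∈-++⁺ˡ J-covers
        (there B∈)  C∈B         → covered-mono (∈-++⁺ʳ J) (I-covers B∈ C∈B)
    leaves-used (resolution {B₁} x B₁∈ _ B₂∈ _ ∷ d)
      with I , I-small , I-covers ← leaves-used d = I , m≤n⇒m≤1+n I-small , λ where
        (here refl) C∈B → [ I-covers B₁∈ , I-covers B₂∈ ]′ (∈-++⁻ B₁ C∈B)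
        (there B∈)  C∈B → I-covers B∈ C∈B
    leaves-used (symmetry {B} φ B∈ B⊆B′ (φ-small , _ , φB′⊆F) ∷ d)
      with I , I-small , I-covers ← leaves-used d = I , m≤n⇒m≤1+n I-small , λ where
        (here refl) C∈φB → image I-covers C∈φB
        (there B∈)  C∈B  → I-covers B∈ C∈B
      where
      image : ∀ {I C} → AllCovered I _ → C ∈ map (actᶜ φ) B → Covered I C
      image I-covers C∈φB with D , D∈B , refl ← ∈-map⁻ (actᶜ φ) C∈φB =
        covered-image φ φ-small (φB′⊆F (map-⊆ᶜ φ B⊆B′ (∈⇒∈ᶜ C∈φB))) (I-covers B∈ D∈B)

    -- Falsifies the leaf a and satisfies every other input clause.
    only-violating : Word n → Fin size → Bool
    only-violating a x with decode x
    ... | inj₂ _ = true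
    ... | inj₁ (p , b) with splitAt n p
    ...   | inj₁ j = lookup a j xor b
    ...   | inj₂ _ = false

    only-violating-rail : ∀ a j b → only-violating a (var (j ↑ˡ m) b) ≡ lookup a j xor b
    only-violating-rail a j b rewrite decode-encode (inj₁ (j ↑ˡ m , b)) | Fin.splitAt-↑ˡ n j m = refl

    -- At a rail where the two words differ, the variable selected by `a′` is the one that
    -- `only-violating a` makes true.
    satisfies-other-leaf : ∀ {a a′} → a ≢ a′ → Satisfies (only-violating a) (clause (leaf a′))
    satisfies-other-leaf {a} {a′} a≢a′ with j , eq ← distinct-words a≢a′ =
      codeLiteral a′ (j ↑ˡ m) , codeLiteral∈leaf⁺ a′ (j ↑ˡ m) , (begin
        only-violating a (var (j ↑ˡ m) (a′ · col (j ↑ˡ m))) ≡⟨ only-violating-rail a j _ ⟩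
        lookup a j xor (a′ · col (j ↑ˡ m))    ≡⟨ cong (λ u → lookup a j xor (a′ · u)) (col-rail j) ⟩
        lookup a j xor (a′ · unit j)          ≡⟨ cong (lookup a j xor_) (trans (·-comm a′ (unit j)) (unit-· j a′)) ⟩
        lookup a j xor lookup a′ j            ≡⟨ Vec.lookup-zipWith _xor_ j a a′ ⟨
        lookup (a ⊕ a′) j                     ≡⟨ eq ⟩
        true                                  ∎)
      where open ≡-Reasoning

    satisfies-short : ∀ a i → Short (clause i) → Satisfies (only-violating a) (clause i)
    satisfies-short a (leaf b) s = ⊥-elim (leaf-not-short 3≤n b {clause (leaf b)} s (mk⇔ id id))
    satisfies-short a (rail j) _ with lookup a j in eq
    ... | false = _ , here refl , cong not (trans (only-violating-rail a j false) (cong (_xor false) eq))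
    ... | true  = _ , there (here refl) , cong not (trans (only-violating-rail a j true) (cong (_xor true) eq))
    satisfies-short a (aux p b) _ = _ , here refl , cong not aux-false
      where
      aux-false : only-violating a (var (n ↑ʳ p) b) ≡ false
      aux-false rewrite decode-encode (inj₁ (n ↑ʳ p , b)) | Fin.splitAt-↑ʳ n m p = refl
    satisfies-short a (idle z) _ = _ , here refl , idle-true
      where
      idle-true : only-violating a (encode (inj₂ z)) ≡ true
      idle-true rewrite decode-encode (inj₂ z) = refl

    satisfies-covered : ∀ {I a C} → ¬ a ∈ I → Covered I C → Satisfies (only-violating a) C
    satisfies-covered {a = a} a∉I (leaf {a′} a′∈I C≈)
      with ℓ , ℓ∈ , eq ← satisfies-other-leaf {a} {a′} (λ { refl → a∉I a′∈I }) = ℓ , from C≈ ℓ∈ , eq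
    satisfies-covered {a = a} a∉I (short {i} s C≈)
      with ℓ , ℓ∈ , eq ← satisfies-short a i s = ℓ , from C≈ ℓ∈ , eq

    -- If a word `a` were missing from `I`, then `only-violating a` would satisfy every source of
    -- the empty clause, against soundness.
    refutation-long : (π : Refutation (srcRule K) Φ) → 2 ^ n ≤ suc (length (Refutation.earlier π))
    refutation-long π with I , I-small , I-covers ← leaves-used (Refutation.derivation π) = begin
      2 ^ n            ≡⟨ length-words n ⟨
      length (words n) ≤⟨ unique-⊆⇒length≤ (words-unique n) (λ {a} _ → all-used a) ⟩
      length I         ≤⟨ I-small ⟩
      suc (length (Refutation.earlier π)) ∎
      where
      open ≤-Reasoning
      all-used : ∀ a → a ∈ I
      all-used a with DecMembership._∈?_ (Vec.≡-dec Bool._≟_) a I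
      ... | yes a∈I = a∈I
      ... | no a∉I with () ← proj₁ (proj₂ (soundness (Refutation.derivation π) (here refl) (only-violating a)
                         (λ C∈ → satisfies-covered a∉I (I-covers (here refl) C∈))))

-- Weights of words

-- With the words of `L` as columns, this is the weight of the codeword of `g`.
count : Word n → List (Word n) → ℕ
count g L = length (filter (λ S → g · S Bool.≟ true) L)

count-++ : (g : Word n) (L M : List (Word n)) → count g (L ++ M) ≡ count g L + count g M
count-++ g L M = trans (cong length (filter-++ _ L M)) (length-++ (filter _ L))

count-map : (g : Word n) (f : A → Word n) (xs : List A) →
            length (filter (λ x → g · f x Bool.≟ true) xs) ≡ count g (map f xs)
count-map g f []       = refl
count-map g f (x ∷ xs) with g · f x
... | false = count-map g f xs
... | true  = cong suc (count-map g f xs)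

ones : Word n → ℕ
ones []          = 0
ones (false ∷ g) = ones g
ones (true ∷ g)  = suc (ones g)

ones-zero : ∀ n → ones (replicate n false) ≡ 0
ones-zero zero    = refl
ones-zero (suc n) = ones-zero n

ones-unit : (j : Fin n) → ones (unit j) ≡ 1
ones-unit {suc n} zero    = cong suc (ones-zero n)
ones-unit         (suc j) = ones-unit j

ones-positive : (g : Word n) (j : Fin n) → lookup g j ≡ true → 1 ≤ ones g
ones-positive (true ∷ g)  j       eq = s≤s z≤n
ones-positive (false ∷ g) (suc j) eq = ones-positive g j eq

units : ∀ n → List (Word n)
units n = tabulate unit

count-false∷ : (x : Bool) (g : Word n) (L : List (Word n)) → count (x ∷ g) (map (false ∷_) L) ≡ count g L
count-false∷ x g []      = refl
count-false∷ x g (S ∷ L) rewrite Bool.∧-zeroʳ x with g · S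
... | false = count-false∷ x g L
... | true  = cong suc (count-false∷ x g L)

count-units : (g : Word n) → count g (units n) ≡ ones g
count-units [] = refl
count-units {suc n} (x ∷ g) = first x (trans (·-comm g _) (zero-· g))
  where
  rest : ∀ x → count (x ∷ g) (tabulate (unit ∘ suc)) ≡ ones g
  rest x = trans (cong (count (x ∷ g)) (sym (map-tabulate unit (false ∷_))))
                 (trans (count-false∷ x g (units n)) (count-units g))
  first : ∀ x → g · replicate n false ≡ false → count (x ∷ g) (units (suc n)) ≡ ones (x ∷ g)
  first false eq rewrite eq = rest false
  first true  eq rewrite eq = cong suc (rest true)

-- Random words

-- The mean for independent bits that are 1 with probability 1/4, scaled by 4 ^ n.
expect : (Word n → ℕ) → ℕ
expect {zero}  f = f []
expect {suc n} f = 3 * expect (f ∘ (false ∷_)) + expect (f ∘ (true ∷_))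

expect-cong : {f h : Word n → ℕ} → (∀ S → f S ≡ h S) → expect f ≡ expect h
expect-cong {zero}  eq = eq []
expect-cong {suc n} eq =
  cong₂ (λ a b → 3 * a + b) (expect-cong (eq ∘ (false ∷_))) (expect-cong (eq ∘ (true ∷_)))

expect-zero : ∀ n → expect {n} (λ _ → 0) ≡ 0
expect-zero zero    = refl
expect-zero (suc n) = cong (λ a → 3 * a + a) (expect-zero n)

expect-+ : (f h : Word n → ℕ) → expect (λ S → f S + h S) ≡ expect f + expect h
expect-+ {zero}  f h = refl
expect-+ {suc n} f h
  rewrite expect-+ (f ∘ (false ∷_)) (h ∘ (false ∷_)) | expect-+ (f ∘ (true ∷_)) (h ∘ (true ∷_)) =
  rearrange (expect (f ∘ (false ∷_))) (expect (h ∘ (false ∷_))) (expect (f ∘ (true ∷_))) (expect (h ∘ (true ∷_)))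
  where
  rearrange : ∀ a b c d → 3 * (a + b) + (c + d) ≡ 3 * a + c + (3 * b + d)
  rearrange = solve-∀

expect-* : (f : Word n → ℕ) (c : ℕ) → expect (λ S → f S * c) ≡ expect f * c
expect-* {zero}  f c = refl
expect-* {suc n} f c rewrite expect-* (f ∘ (false ∷_)) c | expect-* (f ∘ (true ∷_)) c =
  rearrange (expect (f ∘ (false ∷_))) (expect (f ∘ (true ∷_))) c
  where
  rearrange : ∀ a b c → 3 * (a * c) + b * c ≡ (3 * a + b) * c
  rearrange = solve-∀

-- First-moment principle, `4 ^ n` being the total weight. The better of the two words found in the
-- halves is below both means.
at-most-average : (f : Word n → ℕ) → ∃[ S ] 4 ^ n * f S ≤ expect f
at-most-average {zero}  f = [] , ≤-reflexive (+-identityʳ (f []))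
at-most-average {suc n} f
  with S , S≤ ← at-most-average (f ∘ (false ∷_)) | T , T≤ ← at-most-average (f ∘ (true ∷_)) =
  [ (λ fS≤fT → false ∷ S , both≤ (f (false ∷ S)) S≤ (≤-trans (*-monoʳ-≤ (4 ^ n) fS≤fT) T≤))
  , (λ fT≤fS → true ∷ T , both≤ (f (true ∷ T)) (≤-trans (*-monoʳ-≤ (4 ^ n) fT≤fS) S≤) T≤)
  ]′ (≤-total (f (false ∷ S)) (f (true ∷ T)))
  where
  rearrange : ∀ p c → 4 * p * c ≡ 3 * (p * c) + p * c
  rearrange = solve-∀
  both≤ : ∀ c {a b} → 4 ^ n * c ≤ a → 4 ^ n * c ≤ b → 4 ^ suc n * c ≤ 3 * a + b
  both≤ c ≤a ≤b = ≤-trans (≤-reflexive (rearrange (4 ^ n) c)) (+-mono-≤ (*-monoʳ-≤ 3 ≤a) ≤b)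

choose : ℕ → ℕ → Bool → ℕ
choose a b c = if c then b else a

mean : Word n → ℕ → ℕ → ℕ
mean g a b = expect (λ S → choose a b (g · S))

-- With probability 1/4 the new bit of `S` is 1 and flips the product, which exchanges `a` and `b`.
mean-true∷ : (g : Word n) (a b : ℕ) → mean (true ∷ g) a b ≡ 3 * mean g a b + mean g b a
mean-true∷ g a b = cong (3 * mean g a b +_) (expect-cong λ S → Bool.if-not (g · S))

-- At every `S` the two choices add up to `a + b`.
mean-swap : (g : Word n) (a b : ℕ) → mean g a b + mean g b a ≡ 4 ^ n * (a + b)
mean-swap []          a b = sym (+-identityʳ (a + b))
mean-swap {suc n} (x ∷ g) a b = begin
  mean (x ∷ g) a b + mean (x ∷ g) b a ≡⟨ step x ⟩
  4 * (mean g a b + mean g b a)       ≡⟨ cong (4 *_) (mean-swap g a b) ⟩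
  4 * (4 ^ n * (a + b))               ≡⟨ *-assoc 4 (4 ^ n) (a + b) ⟨
  4 ^ suc n * (a + b)                 ∎
  where
  open ≡-Reasoning
  false-case : ∀ p q → (3 * p + p) + (3 * q + q) ≡ 4 * (p + q)
  false-case = solve-∀
  true-case : ∀ p q → (3 * p + q) + (3 * q + p) ≡ 4 * (p + q)
  true-case = solve-∀
  step : ∀ x → mean (x ∷ g) a b + mean (x ∷ g) b a ≡ 4 * (mean g a b + mean g b a)
  step false = false-case (mean g a b) (mean g b a)
  step true  = trans (cong₂ _+_ (mean-true∷ g a b) (mean-true∷ g b a)) (true-case (mean g a b) (mean g b a))

mean-false∷ : (g : Word n) (a b : ℕ) → mean (false ∷ g) a b ≡ 4 * mean g a b
mean-false∷ g a b = +-comm (3 * mean g a b) (mean g a b)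

mean-ones≡0 : (g : Word n) (a b : ℕ) → ones g ≡ 0 → mean g a b ≡ 4 ^ n * a
mean-ones≡0 []              a b _  = sym (+-identityʳ a)
mean-ones≡0 {suc n} (false ∷ g) a b eq =
  trans (mean-false∷ g a b) (trans (cong (4 *_) (mean-ones≡0 g a b eq)) (sym (*-assoc 4 (4 ^ n) a)))

mean-ones≡1 : (g : Word n) (a b : ℕ) → ones g ≡ 1 → 4 * mean g a b ≡ 4 ^ n * (3 * a + b)
mean-ones≡1 {suc n} (false ∷ g) a b eq =
  trans (cong (4 *_) (trans (mean-false∷ g a b) (mean-ones≡1 g a b eq))) (sym (*-assoc 4 (4 ^ n) (3 * a + b)))
mean-ones≡1 {suc n} (true ∷ g)  a b eq
  rewrite mean-true∷ g a b | mean-ones≡0 g a b (suc-injective eq) | mean-ones≡0 g b a (suc-injective eq) =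
  rearrange (4 ^ n) a b
  where
  rearrange : ∀ p a b → 4 * (3 * (p * a) + p * b) ≡ 4 * p * (3 * a + b)
  rearrange = solve-∀

-- If the product is 1 with probability p, a further bit 1 in `g` makes this 1/4 + p/2, which is at
-- least 3/8 once p is at least 1/4. As `b ≤ a`, a larger probability only lowers the mean.
mean-ones≥2 : (g : Word n) (a b : ℕ) → b ≤ a → 2 ≤ ones g → 8 * mean g a b ≤ 4 ^ n * (5 * a + 3 * b)
mean-ones≥2 {suc n} (false ∷ g) a b b≤a 2≤ = begin
  8 * mean (false ∷ g) a b    ≡⟨ cong (8 *_) (mean-false∷ g a b) ⟩
  8 * (4 * mean g a b)        ≡⟨ rearrange₁ (mean g a b) ⟩
  4 * (8 * mean g a b)        ≤⟨ *-monoʳ-≤ 4 (mean-ones≥2 g a b b≤a 2≤) ⟩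
  4 * (4 ^ n * (5 * a + 3 * b)) ≡⟨ *-assoc 4 (4 ^ n) _ ⟨
  4 ^ suc n * (5 * a + 3 * b) ∎
  where
  open ≤-Reasoning
  rearrange₁ : ∀ p → 8 * (4 * p) ≡ 4 * (8 * p)
  rearrange₁ = solve-∀
mean-ones≥2 {suc n} (true ∷ g) a b b≤a (s≤s 1≤) = begin
  8 * mean (true ∷ g) a b
    ≡⟨ cong (8 *_) (mean-true∷ g a b) ⟩
  8 * (3 * mean g a b + mean g b a)
    ≡⟨ rearrange₁ (mean g a b) (mean g b a) ⟩
  2 * (8 * mean g a b) + 8 * (mean g a b + mean g b a)
    -- For the tail the bound for probability 1/4 is enough: it is exact for one bit and weaker than
    -- 3/8 for more.
    ≤⟨ +-mono-≤ (*-monoʳ-≤ 2 (tail-bound (m≤n⇒m<n∨m≡n 1≤))) (≤-reflexive (cong (8 *_) (mean-swap g a b))) ⟩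
  2 * (4 ^ n * (6 * a + 2 * b)) + 8 * (4 ^ n * (a + b))
    ≡⟨ rearrange₂ (4 ^ n) a b ⟩
  4 ^ suc n * (5 * a + 3 * b) ∎
  where
  open ≤-Reasoning
  rearrange₁ : ∀ p q → 8 * (3 * p + q) ≡ 2 * (8 * p) + 8 * (p + q)
  rearrange₁ = solve-∀
  rearrange₂ : ∀ p a b → 2 * (p * (6 * a + 2 * b)) + 8 * (p * (a + b)) ≡ 4 * p * (5 * a + 3 * b)
  rearrange₂ = solve-∀
  rearrange₃ : ∀ p a b → 2 * (p * (3 * a + b)) ≡ p * (6 * a + 2 * b)
  rearrange₃ = solve-∀
  rearrange₄ : ∀ a b → 5 * a + 3 * b ≡ 5 * a + 2 * b + b
  rearrange₄ = solve-∀
  rearrange₅ : ∀ a b → 5 * a + 2 * b + a ≡ 6 * a + 2 * b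
  rearrange₅ = solve-∀
  tail-bound : 1 < ones g ⊎ 1 ≡ ones g → 8 * mean g a b ≤ 4 ^ n * (6 * a + 2 * b)
  tail-bound (inj₁ 2≤) = begin
    8 * mean g a b            ≤⟨ mean-ones≥2 g a b b≤a 2≤ ⟩
    4 ^ n * (5 * a + 3 * b)   ≡⟨ cong (4 ^ n *_) (rearrange₄ a b) ⟩
    4 ^ n * (5 * a + 2 * b + b) ≤⟨ *-monoʳ-≤ (4 ^ n) (+-monoʳ-≤ (5 * a + 2 * b) b≤a) ⟩
    4 ^ n * (5 * a + 2 * b + a) ≡⟨ cong (4 ^ n *_) (rearrange₅ a b) ⟩
    4 ^ n * (6 * a + 2 * b)   ∎
  tail-bound (inj₂ 1≡) = ≤-reflexive (trans (*-assoc 2 4 (mean g a b))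
    (trans (cong (2 *_) (mean-ones≡1 g a b (sym 1≡))) (rearrange₃ (4 ^ n) a b)))

-- Codes

-- For a random S whose bits are 1 with probability 1/4, the bit g · S is 1
-- with probability 1/4 if g has a single bit 1, and with probability at least
-- 3/8 if it has more.  Hence the costs average to at most 45/4.  They penalise
-- weights above (resp. below) one third of the number of columns.
cost : ℕ → Bool → ℕ
cost 0 = choose 0 0
cost 1 = choose 10 15
cost _ = choose 12 10

cost-average : (g : Word n) → 4 * expect (λ S → cost (ones g) (g · S)) ≤ 4 ^ n * 45
cost-average {n} g with ones g in eq
... | 0 = begin
  4 * mean g 0 0   ≡⟨ cong (4 *_) (mean-ones≡0 g 0 0 eq) ⟩
  4 * (4 ^ n * 0)  ≡⟨ cong (4 *_) (*-zeroʳ (4 ^ n)) ⟩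
  0                ≤⟨ z≤n ⟩
  4 ^ n * 45       ∎
  where open ≤-Reasoning
-- The bound 45 is 3 * 10 + 15 for one bit, and half of 5 * 12 + 3 * 10 for several.
... | 1 = ≤-reflexive (mean-ones≡1 g 10 15 eq)
... | suc (suc _) = *-cancelˡ-≤ 2 (begin
  2 * (4 * mean g 12 10) ≡⟨ *-assoc 2 4 (mean g 12 10) ⟨
  8 * mean g 12 10       ≤⟨ mean-ones≥2 g 12 10 (m≤m+n 10 2) (subst (2 ≤_) (sym eq) (s≤s (s≤s z≤n))) ⟩
  4 ^ n * 90             ≡⟨ rearrange (4 ^ n) ⟩
  2 * (4 ^ n * 45)       ∎)
  where
  open ≤-Reasoning
  rearrange : ∀ p → p * 90 ≡ 2 * (p * 45)
  rearrange = solve-∀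

-- Derandomised choice of columns.

score : (Bool → ℕ) → Word n → List (Word n) → ℕ
score v g []      = 1
score v g (S ∷ L) = v (g · S) * score v g L

total : (Word n → ℕ) → List (Word n) → ℕ
total f gs = sum (map f gs)

-- The pessimistic estimator of the method of conditional expectations: a bound on this sum bounds
-- the score of every word at once.
potential : List (Word n) → ℕ
potential L = total (λ g → score (cost (ones g)) g L) (words _)

∈⇒≤total : (f : Word n → ℕ) {g : Word n} {gs : List (Word n)} → g ∈ gs → f g ≤ total f gs
∈⇒≤total f (here refl) = m≤m+n _ _
∈⇒≤total f (there g∈)  = ≤-trans (∈⇒≤total f g∈) (m≤n+m _ _)

potential-[] : ∀ n → potential {n} [] ≡ 2 ^ n
potential-[] n = trans (total-1 (words n)) (length-words n)
  where
  total-1 : (gs : List (Word n)) → total (λ _ → 1) gs ≡ length gs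
  total-1 []       = refl
  total-1 (_ ∷ gs) = cong suc (total-1 gs)

total-average : ∀ {c} (v : Word n → Word n → ℕ) (f : Word n → ℕ) → (∀ g → 4 * expect (v g) ≤ 4 ^ n * c) →
                ∀ gs → 4 * expect (λ S → total (λ g → v g S * f g) gs) ≤ 4 ^ n * (c * total f gs)
total-average {n} v f v≤ [] rewrite expect-zero n = z≤n
total-average {n} {c} v f v≤ (g ∷ gs) = begin
  4 * expect (λ S → v g S * f g + rest S)           ≡⟨ cong (4 *_) (expect-+ (λ S → v g S * f g) rest) ⟩
  4 * (expect (λ S → v g S * f g) + expect rest)    ≡⟨ cong (λ e → 4 * (e + expect rest)) (expect-* (v g) (f g)) ⟩
  4 * (expect (v g) * f g + expect rest)            ≡⟨ rearrange₁ (expect (v g)) (f g) (expect rest) ⟩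
  4 * expect (v g) * f g + 4 * expect rest          ≤⟨ +-mono-≤ (*-monoˡ-≤ (f g) (v≤ g)) (total-average v f v≤ gs) ⟩
  4 ^ n * c * f g + 4 ^ n * (c * total f gs)        ≡⟨ rearrange₂ (4 ^ n) c (f g) (total f gs) ⟩
  4 ^ n * (c * (f g + total f gs))                  ∎
  where
  open ≤-Reasoning
  rest : Word n → ℕ
  rest S = total (λ g → v g S * f g) gs
  rearrange₁ : ∀ a b c → 4 * (a * b + c) ≡ 4 * a * b + 4 * c
  rearrange₁ = solve-∀
  rearrange₂ : ∀ p c a b → p * c * a + p * (c * b) ≡ p * (c * (a + b))
  rearrange₂ = solve-∀

-- Some column does no worse than the mean, and by linearity of expectation the mean is at most 45/4
-- times the old potential.
extend : (L : List (Word n)) → ∃[ S ] 4 * potential (S ∷ L) ≤ 45 * potential L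
extend {n} L with S , S≤ ← at-most-average (λ S → potential (S ∷ L)) =
  S , *-cancelˡ-≤ (4 ^ n) {{m^n≢0 4 n}} (begin
    4 ^ n * (4 * potential (S ∷ L))        ≡⟨ rearrange (4 ^ n) (potential (S ∷ L)) ⟩
    4 * (4 ^ n * potential (S ∷ L))        ≤⟨ *-monoʳ-≤ 4 S≤ ⟩
    4 * expect (λ S → potential (S ∷ L))   ≤⟨ total-average (λ g S → cost (ones g) (g · S)) _ cost-average (words n) ⟩
    4 ^ n * (45 * potential L)             ∎)
  where
  open ≤-Reasoning
  rearrange : ∀ p c → p * (4 * c) ≡ 4 * (p * c)
  rearrange = solve-∀

columns : ∀ n M → Σ[ L ∈ List (Word n) ] length L ≡ M × 4 ^ M * potential L ≤ 45 ^ M * 2 ^ n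
columns n zero = [] , refl , ≤-reflexive (cong (1 *_) (potential-[] n))
columns n (suc M) with L , |L| , L≤ ← columns n M with S , S≤ ← extend L = S ∷ L , cong suc |L| , (begin
  4 * 4 ^ M * potential (S ∷ L)   ≡⟨ rearrange 4 (4 ^ M) (potential (S ∷ L)) ⟩
  4 ^ M * (4 * potential (S ∷ L)) ≤⟨ *-monoʳ-≤ (4 ^ M) S≤ ⟩
  4 ^ M * (45 * potential L)      ≡⟨ rearrange 45 (4 ^ M) (potential L) ⟨
  45 * 4 ^ M * potential L        ≡⟨ *-assoc 45 (4 ^ M) (potential L) ⟩
  45 * (4 ^ M * potential L)      ≤⟨ *-monoʳ-≤ 45 L≤ ⟩
  45 * (45 ^ M * 2 ^ n)           ≡⟨ *-assoc 45 (45 ^ M) (2 ^ n) ⟨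
  45 ^ suc M * 2 ^ n              ∎)
  where
  open ≤-Reasoning
  rearrange : ∀ c p q → c * p * q ≡ p * (c * q)
  rearrange = solve-∀

-- From scores to weights.

module _ {a b : ℕ} (g : Word n) where

  private
    shuffle : ∀ p q r s → p * q * (r * s) ≡ p * r * (q * s)
    shuffle = solve-∀

    extract : ∀ p q r → p * (q * r) ≡ q * (p * r)
    extract = solve-∀

    bit-0 : ∀ k l {s} → b ^ k * a ^ l ≤ a ^ k * s → b ^ k * a ^ suc l ≤ a ^ k * (a * s)
    bit-0 k l {s} ≤s = subst₂ _≤_ (sym (extract (b ^ k) a (a ^ l))) (sym (extract (a ^ k) a s)) (*-monoʳ-≤ a ≤s)

    bit-1 : ∀ k l {s} → b ^ k * a ^ l ≤ a ^ k * s → b ^ suc k * a ^ suc l ≤ a ^ suc k * (b * s)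
    bit-1 k l {s} ≤s = subst₂ _≤_ (shuffle b a (b ^ k) (a ^ l))
      (trans (cong (_* (a ^ k * s)) (*-comm b a)) (shuffle a b (a ^ k) s)) (*-monoʳ-≤ (b * a) ≤s)

  -- A word with count c scores `b` to the c times `a` to the number of remaining columns, which
  -- grows with c as `a ≤ b`. The factor `a ^ k` avoids subtraction. `score-light` is the mirror
  -- image.
  score-heavy : a ≤ b → ∀ k L → k ≤ count g L → b ^ k * a ^ length L ≤ a ^ k * score (choose a b) g L
  score-heavy a≤b zero    [] _ = ≤-refl
  score-heavy a≤b k (S ∷ L) k≤ with g · S
  ... | false = bit-0 k (length L) (score-heavy a≤b k L k≤)
  score-heavy a≤b zero    (S ∷ L) k≤ | true =
    *-monoʳ-≤ 1 (*-mono-≤ a≤b (subst₂ _≤_ (*-identityˡ _) (*-identityˡ _) (score-heavy a≤b zero L z≤n)))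
  score-heavy a≤b (suc k) (S ∷ L) k≤ | true = bit-1 k (length L) (score-heavy a≤b k L (≤-pred k≤))

  score-light : b ≤ a → ∀ k L → count g L ≤ k → b ^ k * a ^ length L ≤ a ^ k * score (choose a b) g L
  score-light b≤a k [] _ = *-monoˡ-≤ 1 (^-monoˡ-≤ k b≤a)
  score-light b≤a k (S ∷ L) ≤k with g · S
  ... | false = bit-0 k (length L) (score-light b≤a k L ≤k)
  score-light b≤a (suc k) (S ∷ L) ≤k | true = bit-1 k (length L) (score-light b≤a k L (≤-pred ≤k))

^-distribʳ-* : ∀ a b k → (a * b) ^ k ≡ a ^ k * b ^ k
^-distribʳ-* a b zero    = refl
^-distribʳ-* a b (suc k) = trans (cong (a * b *_) (^-distribʳ-* a b k)) (shuffle a b (a ^ k) (b ^ k))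
  where
  shuffle : ∀ a b p q → a * b * (p * q) ≡ a * p * (b * q)
  shuffle = solve-∀

-- When a third of the columns count, the score is (a * a * b) ^ k. The two cost pairs give 10 * 10
-- * 15 = 1500 and 12 * 12 * 10 = 1440.
1440^k≤score : ∀ {a b} k (g : Word n) L → length L ≡ 3 * k → .{{_ : NonZero a}} → 1440 * a ≤ b * a ^ 3 →
               b ^ k * a ^ length L ≤ a ^ k * score (choose a b) g L → 1440 ^ k ≤ score (choose a b) g L
1440^k≤score {a = a} {b} k g L |L| 1440≤ score≥ = *-cancelˡ-≤ (a ^ k) {{m^n≢0 a k}} (begin
  a ^ k * 1440 ^ k                ≡⟨ *-comm (a ^ k) (1440 ^ k) ⟩
  1440 ^ k * a ^ k                ≡⟨ ^-distribʳ-* 1440 a k ⟨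
  (1440 * a) ^ k                  ≤⟨ ^-monoˡ-≤ k 1440≤ ⟩
  (b * a ^ 3) ^ k                 ≡⟨ ^-distribʳ-* b (a ^ 3) k ⟩
  b ^ k * (a ^ 3) ^ k             ≡⟨ cong (b ^ k *_) (^-*-assoc a 3 k) ⟩
  b ^ k * a ^ (3 * k)             ≡⟨ cong (λ l → b ^ k * a ^ l) |L| ⟨
  b ^ k * a ^ length L            ≤⟨ score≥ ⟩
  a ^ k * score (choose a b) g L  ∎)
  where open ≤-Reasoning

-- 45 ^ 3 = 45 * 2025 and 4 ^ 3 * 1440 = 45 * 2048, and (2048 / 2025) ^ 64 > 2.
potential-small : ∀ n k → 1 ≤ n → 64 * n ≤ k → 45 ^ (3 * k) * 2 ^ n < 4 ^ (3 * k) * 1440 ^ k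
potential-small n@(suc _) k 1≤n 64n≤k = begin-strict
  45 ^ (3 * k) * 2 ^ n                          ≡⟨ cong (_* 2 ^ n) (^-*-assoc 45 3 k) ⟨
  91125 ^ k * 2 ^ n                             ≡⟨ cong (λ k → 91125 ^ k * 2 ^ n) k≡ ⟨
  91125 ^ (64 * n + r) * 2 ^ n                  ≡⟨ cong (_* 2 ^ n) (^-distribˡ-+-* 91125 (64 * n) r) ⟩
  91125 ^ (64 * n) * 91125 ^ r * 2 ^ n          ≡⟨ rearrange (91125 ^ (64 * n)) (91125 ^ r) (2 ^ n) ⟩
  91125 ^ r * (2 ^ n * 91125 ^ (64 * n))        ≡⟨ cong (λ p → 91125 ^ r * (2 ^ n * p)) (^-*-assoc 91125 64 n) ⟨
  91125 ^ r * (2 ^ n * (91125 ^ 64) ^ n)        ≡⟨ cong (91125 ^ r *_) (^-distribʳ-* 2 (91125 ^ 64) n) ⟨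
  91125 ^ r * (2 * 91125 ^ 64) ^ n              <⟨ *-monoʳ-< (91125 ^ r) {{m^n≢0 91125 r}} (^-monoˡ-< n doubled) ⟩
  91125 ^ r * (92160 ^ 64) ^ n                  ≤⟨ *-monoˡ-≤ ((92160 ^ 64) ^ n) (^-monoˡ-≤ r 91125≤92160) ⟩
  92160 ^ r * (92160 ^ 64) ^ n                  ≡⟨ cong (92160 ^ r *_) (^-*-assoc 92160 64 n) ⟩
  92160 ^ r * 92160 ^ (64 * n)                  ≡⟨ *-comm (92160 ^ r) _ ⟩
  92160 ^ (64 * n) * 92160 ^ r                  ≡⟨ ^-distribˡ-+-* 92160 (64 * n) r ⟨
  92160 ^ (64 * n + r)                          ≡⟨ cong (92160 ^_) k≡ ⟩
  92160 ^ k                                     ≡⟨ ^-distribʳ-* 64 1440 k ⟩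
  64 ^ k * 1440 ^ k                             ≡⟨ cong (_* 1440 ^ k) (^-*-assoc 4 3 k) ⟩
  4 ^ (3 * k) * 1440 ^ k                        ∎
  where
  open ≤-Reasoning
  r : ℕ
  r = k ∸ 64 * n
  k≡ : 64 * n + r ≡ k
  k≡ = m+[n∸m]≡n 64n≤k
  rearrange : ∀ a b c → a * b * c ≡ b * (c * a)
  rearrange = solve-∀
  doubled : 2 * 91125 ^ 64 < 92160 ^ 64
  doubled = <ᵇ⇒< (2 * 91125 ^ 64) (92160 ^ 64) _
  91125≤92160 : 91125 ≤ 92160
  91125≤92160 = ≤ᵇ⇒≤ 91125 92160 _

-- Codes whose generators attain the minimum distance.

record GapCode (n k l : ℕ) : Set where
  field
    cols        : List (Word n)
    length-cols : length cols ≤ l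
    -- Together with its rail a generator weighs at most `k`, so it can be topped up to exactly `k`;
    -- sums of several generators must weigh `k` already.
    light       : ∀ g → ones g ≡ 1 → count g cols < k
    heavy       : ∀ g → 2 ≤ ones g → k ≤ ones g + count g cols

-- A word of the wrong weight would score at least `1440 ^ k`, more than the whole potential.
dense-code : ∀ n k → 1 ≤ n → 64 * n ≤ k → GapCode n k (3 * k)
dense-code n k 1≤n 64n≤k with L , |L| , L≤ ← columns n (3 * k) = record
  { cols        = L
  ; length-cols = ≤-reflexive |L|
  ; light       = light
  ; heavy       = λ g 2≤ → ≤-trans (heavy g 2≤) (m≤n+m (count g L) (ones g))
  }
  where
  potential<1440^k : potential L < 1440 ^ k
  potential<1440^k = *-cancelˡ-< (4 ^ (3 * k)) _ _ (≤-<-trans L≤ (potential-small n k 1≤n 64n≤k))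
  score<1440^k : ∀ g → score (cost (ones g)) g L < 1440 ^ k
  score<1440^k g = ≤-<-trans (∈⇒≤total (λ g → score (cost (ones g)) g L) (∈-words g)) potential<1440^k
  light : ∀ g → ones g ≡ 1 → count g L < k
  light g 1≡ = ≰⇒> λ k≤ → <⇒≱ (subst (λ w → score (cost w) g L < 1440 ^ k) 1≡ (score<1440^k g))
    (1440^k≤score k g L |L| (≤ᵇ⇒≤ 14400 15000 _) (score-heavy g (≤ᵇ⇒≤ 10 15 _) k L k≤))
  heavy : ∀ g → 2 ≤ ones g → k ≤ count g L
  heavy g 2≤ with ones g | score<1440^k g
  heavy g (s≤s (s≤s _)) | suc (suc _) | score< = ≮⇒≥ λ count< → <⇒≱ score<
    (1440^k≤score k g L |L| (≤ᵇ⇒≤ 17280 17280 _) (score-light g (≤ᵇ⇒≤ 10 12 _) k L (<⇒≤ count<)))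

-- Together with the rails, every message bit appears `suc k` times.
repetition-code : ∀ n k → GapCode n (suc k) (k * n)
repetition-code n k = record
  { cols        = concat (replicateᴸ k (units n))
  ; length-cols = ≤-reflexive (length-repeat k)
  ; light       = λ g 1≡ → s≤s (≤-reflexive (trans (count-repeat g k) (trans (cong (k *_) 1≡) (*-identityʳ k))))
  ; heavy       = λ g 1< → subst (suc k ≤_) (cong (ones g +_) (sym (count-repeat g k)))
                             (+-mono-≤ (<⇒≤ 1<) (≤-trans (≤-reflexive (sym (*-identityʳ k))) (*-monoʳ-≤ k (<⇒≤ 1<))))
  }
  where
  length-repeat : ∀ k → length (concat (replicateᴸ k (units n))) ≡ k * n
  length-repeat zero    = refl
  length-repeat (suc k) = trans (length-++ (units n)) (cong₂ _+_ (length-tabulate unit) (length-repeat k))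
  count-repeat : ∀ g k → count g (concat (replicateᴸ k (units n))) ≡ k * ones g
  count-repeat g zero    = refl
  count-repeat g (suc k) = trans (count-++ g (units n) _) (cong₂ _+_ (count-units g) (count-repeat g k))

-- Raises the weight of unit j by need j, for all j with the same columns.
fill : (Fin n → ℕ) → ℕ → List (Word n)
fill need zero    = []
fill need (suc r) = Vec.tabulate (λ j → r <ᵇ need j) ∷ fill need r

length-fill : (need : Fin n → ℕ) (r : ℕ) → length (fill need r) ≡ r
length-fill need zero    = refl
length-fill need (suc r) = cong suc (length-fill need r)

-- Bit `j` is 1 in the columns with index below `need j`, so the count is the minimum of `r` and
-- `need j`.
count-fill : (need : Fin n → ℕ) (j : Fin n) (r : ℕ) → need j ≤ r → count (unit j) (fill need r) ≡ need j
count-fill need j r need≤r = trans (count-⊓ r) (m≥n⇒m⊓n≡n need≤r)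
  where
  count-⊓ : ∀ r → count (unit j) (fill need r) ≡ r ⊓ need j
  count-⊓ zero    = refl
  count-⊓ (suc r) rewrite unit-· j (Vec.tabulate (λ j → r <ᵇ need j)) | Vec.lookup∘tabulate (λ j → r <ᵇ need j) j
    with r <ᵇ need j in eq
  ... | true  = trans (cong suc (trans (count-⊓ r) (m≤n⇒m⊓n≡m (<⇒≤ r<need)))) (sym (m≤n⇒m⊓n≡m r<need))
    where r<need = <ᵇ⇒< r (need j) (subst T (sym eq) _)
  ... | false = trans (count-⊓ r) (trans (m≥n⇒m⊓n≡n need≤r′) (sym (m≥n⇒m⊓n≡n (m≤n⇒m≤1+n need≤r′))))
    where need≤r′ = ≮⇒≥ λ r<need → subst T eq (<⇒<ᵇ r<need)

-- The rails add `ones g` to the weight of a codeword, which is the summand 1 for a generator.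
record Code (n k l : ℕ) : Set where
  field
    cols        : List (Word n)
    length-cols : length cols ≤ l
    unit-weight : ∀ j → 1 + count (unit j) cols ≡ k
    distance    : ∀ g → 1 ≤ ones g → k ≤ ones g + count g cols

ones≡1⇒unit : (g : Word n) → ones g ≡ 1 → ∃[ j ] g ≡ unit j
ones≡1⇒unit (false ∷ g) eq with j , refl ← ones≡1⇒unit g eq = suc j , refl
ones≡1⇒unit (true ∷ g)  eq = zero , cong (true ∷_) (ones≡0⇒zero g (suc-injective eq))
  where
  ones≡0⇒zero : (g : Word n) → ones g ≡ 0 → g ≡ replicate _ false
  ones≡0⇒zero []          _  = refl
  ones≡0⇒zero (false ∷ g) eq = cong (false ∷_) (ones≡0⇒zero g eq)

-- No generator needs more than `k` further ones, and additional columns never lower the weight of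
-- another word.
balance : ∀ {k l} → GapCode n (suc k) l → Code n (suc k) (l + k)
balance {n} {k} {l} C = record
  { cols        = cols ++ fill need k
  ; length-cols = begin
      length (cols ++ fill need k)          ≡⟨ length-++ cols ⟩
      length cols + length (fill need k)    ≡⟨ cong (length cols +_) (length-fill need k) ⟩
      length cols + k                       ≤⟨ +-monoˡ-≤ k length-cols ⟩
      l + k                                 ∎
  ; unit-weight = unit-weight
  ; distance    = distance
  }
  where
  open GapCode C
  open ≤-Reasoning
  need : Fin n → ℕ
  need j = k ∸ count (unit j) cols
  unit-weight : ∀ j → 1 + count (unit j) (cols ++ fill need k) ≡ suc k
  unit-weight j = cong suc (begin-equality
    count (unit j) (cols ++ fill need k)                  ≡⟨ count-++ (unit j) cols (fill need k) ⟩
    count (unit j) cols + count (unit j) (fill need k)    ≡⟨ cong (count (unit j) cols +_)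
                                                               (count-fill need j k (m∸n≤m k (count (unit j) cols))) ⟩
    count (unit j) cols + (k ∸ count (unit j) cols)       ≡⟨ m+[n∸m]≡n (≤-pred (light (unit j) (ones-unit j))) ⟩
    k                                                     ∎)
  distance : ∀ g → 1 ≤ ones g → suc k ≤ ones g + count g (cols ++ fill need k)
  distance g 1≤ with m≤n⇒m<n∨m≡n 1≤
  ... | inj₁ 2≤ = begin
    suc k                                 ≤⟨ heavy g 2≤ ⟩
    ones g + count g cols                 ≤⟨ +-monoʳ-≤ (ones g) (m≤m+n (count g cols) _) ⟩
    ones g + (count g cols + count g (fill need k)) ≡⟨ cong (ones g +_) (count-++ g cols (fill need k)) ⟨
    ones g + count g (cols ++ fill need k) ∎
  ... | inj₂ 1≡ with j , refl ← ones≡1⇒unit g (sym 1≡) =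
    ≤-reflexive (sym (trans (cong (_+ count (unit j) (cols ++ fill need k)) (sym 1≡)) (unit-weight j)))

-- The separation

allFin-++ : ∀ n {m} (f : Fin (n + m) → A) →
            map f (allFin (n + m)) ≡ tabulate (f ∘ (_↑ˡ m)) ++ tabulate (f ∘ (n ↑ʳ_))
allFin-++ n f = trans (map-tabulate id f) (tabulate-++ n f)
  where
  tabulate-++ : ∀ n {m} (f : Fin (n + m) → A) → tabulate f ≡ tabulate (f ∘ (_↑ˡ m)) ++ tabulate (f ∘ (n ↑ʳ_))
  tabulate-++ zero    f = refl
  tabulate-++ (suc n) f = cong (f zero ∷_) (tabulate-++ n (f ∘ suc))

position-word : (cols : List (Word n)) → Fin (n + length cols) → Word n
position-word {n} cols p = [ unit , lookupᴸ cols ]′ (splitAt n p)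

position-rail : (cols : List (Word n)) (j : Fin n) → position-word cols (j ↑ˡ length cols) ≡ unit j
position-rail {n} cols j = cong [ unit , lookupᴸ cols ]′ (Fin.splitAt-↑ˡ n j (length cols))

position-count : (cols : List (Word n)) (g : Word n) →
                 length (filter (λ p → g · position-word cols p Bool.≟ true) (allFin (n + length cols)))
                 ≡ ones g + count g cols
position-count {n} cols g = begin
  length (filter (λ p → g · position-word cols p Bool.≟ true) (allFin (n + length cols)))
    ≡⟨ count-map g (position-word cols) (allFin (n + length cols)) ⟩
  count g (map (position-word cols) (allFin (n + length cols)))
    ≡⟨ cong (count g) (trans (allFin-++ n (position-word cols)) (cong₂ _++_ rails others)) ⟩
  count g (units n ++ cols)
    ≡⟨ count-++ g (units n) cols ⟩
  count g (units n) + count g cols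
    ≡⟨ cong (_+ count g cols) (count-units g) ⟩
  ones g + count g cols ∎
  where
  open ≡-Reasoning
  rails : tabulate (position-word cols ∘ (_↑ˡ length cols)) ≡ units n
  rails = tabulate-cong (position-rail cols)
  others : tabulate (position-word cols ∘ (n ↑ʳ_)) ≡ cols
  others = trans (tabulate-cong λ q → cong [ unit , lookupᴸ cols ]′ (Fin.splitAt-↑ʳ n (length cols) q))
                 (tabulate-lookup cols)

record Separating (K : ℕ → ℕ) (n : ℕ) : Set where
  field
    formula       : CNF
    unsatisfiable : Unsatisfiable formula
    upper         : Σ[ π ∈ Refutation (srRule (λ N → 2 * K N)) formula ]
                      suc (length (Refutation.earlier π)) ≤ 768 * n ^ 2
    lower         : (π : Refutation (srcRule (λ N → 2 * K N ∸ 1)) formula) →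
                      2 ^ n ≤ suc (length (Refutation.earlier π))

-- A generator moves `2 * suc k` variables, just what the first bound allows; the second falls one
-- short of the smallest nonzero codeword.
code⇒separating : ∀ {k l} (K : ℕ → ℕ) n → 3 ≤ n → Code n (suc k) l → (n + l) * 2 ≤ 256 * n ^ 2 →
                  K (256 * n ^ 2) ≡ suc k → Separating K n
code⇒separating {k} {l} K n 3≤n C l≤ K≡ = record
  { formula       = Φ
  ; unsatisfiable = Formula.unsatisfiable col col-rail (λ N → 2 * K N) unit-bound
  ; upper         = let π , π-short , _ = Formula.refutation col col-rail (λ N → 2 * K N) unit-bound
                    in π , ≤-trans π-short steps-bound
  ; lower         = Formula.refutation-long col col-rail (λ N → 2 * K N ∸ 1) 3≤n heavy
  }
  where
  open Code C
  open ≤-Reasoning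
  N m pad : ℕ
  N   = 256 * n ^ 2
  m   = length cols
  pad = N ∸ (n + m) * 2
  col : Fin (n + m) → Word n
  col = position-word cols
  col-rail : ∀ j → col (j ↑ˡ m) ≡ unit j
  col-rail = position-rail cols
  open Formula {n} {m} {pad} col col-rail using (Φ; weight; size)

  fits : (n + m) * 2 ≤ N
  fits = ≤-trans (*-monoˡ-≤ 2 (+-monoʳ-≤ n length-cols)) l≤

  K-size : K size ≡ suc k
  K-size = trans (cong K (m+[n∸m]≡n fits)) K≡

  unit-bound : ∀ j → weight (unit j) * 2 ≤ 2 * K size
  unit-bound j = ≤-reflexive (begin-equality
    weight (unit j) * 2                           ≡⟨ *-comm (weight (unit j)) 2 ⟩
    2 * weight (unit j)                           ≡⟨ cong (2 *_) (position-count cols (unit j)) ⟩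
    2 * (ones (unit j) + count (unit j) cols)     ≡⟨ cong (λ w → 2 * (w + count (unit j) cols)) (ones-unit j) ⟩
    2 * (1 + count (unit j) cols)                 ≡⟨ cong (2 *_) (trans (unit-weight j) (sym K-size)) ⟩
    2 * K size                                    ∎)

  heavy : ∀ g j → lookup g j ≡ true → 2 * K size ∸ 1 < weight g * 2
  heavy g j eq = begin-strict
    2 * K size ∸ 1                   ≡⟨ cong (λ x → 2 * x ∸ 1) K-size ⟩
    -- The truncated subtraction is a true predecessor because `K size` is positive.
    2 * suc k ∸ 1                    <⟨ ≤-refl ⟩
    2 * suc k                        ≤⟨ *-monoʳ-≤ 2 (distance g (ones-positive g j eq)) ⟩
    2 * (ones g + count g cols)      ≡⟨ cong (2 *_) (position-count cols g) ⟨
    2 * weight g                     ≡⟨ *-comm 2 (weight g) ⟩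
    weight g * 2                     ∎

  steps-bound : suc (n * 4 + m * 2) ≤ 768 * n ^ 2
  steps-bound = begin
    -- The slack `m * 2` completes the count to twice the number of code variables, plus one.
    suc (n * 4 + m * 2)                ≤⟨ m≤m+n _ (m * 2) ⟩
    suc (n * 4 + m * 2) + m * 2        ≡⟨ rearrange n m ⟩
    2 * ((n + m) * 2) + 1              ≤⟨ +-mono-≤ (*-monoʳ-≤ 2 fits) N≥1 ⟩
    2 * N + N                          ≡⟨ triple (n ^ 2) ⟩
    768 * n ^ 2                        ∎
    where
    N≥1 : 1 ≤ N
    N≥1 = *-mono-≤ (≤ᵇ⇒≤ 1 256 _) (^-monoˡ-≤ 2 (≤-trans (s≤s z≤n) 3≤n))
    rearrange : ∀ n m → suc (n * 4 + m * 2) + m * 2 ≡ 2 * ((n + m) * 2) + 1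
    rearrange = solve-∀
    triple : ∀ q → 2 * (256 * q) + 256 * q ≡ 768 * q
    triple = solve-∀

-- If the repetition code does not fit, then `suc k` is at least `64 * n` and the dense code exists.
-- It has at most `5 * suc k` positions with two variables each, hence the factor 10.
separating : ∀ {k} (K : ℕ → ℕ) n → 3 ≤ n → K (256 * n ^ 2) ≡ suc k → 10 * suc k ≤ 256 * n ^ 2 → Separating K n
separating {k} K n 3≤n K≡ small with 2 * (suc n * suc k) ≤? 256 * n ^ 2
... | yes fits = code⇒separating K n 3≤n (balance (repetition-code n k)) (begin
    (n + (k * n + k)) * 2      ≤⟨ m≤m+n _ 2 ⟩
    (n + (k * n + k)) * 2 + 2  ≡⟨ rearrange n k ⟩
    2 * (suc n * suc k)        ≤⟨ fits ⟩
    256 * n ^ 2                ∎) K≡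
  where
  open ≤-Reasoning
  rearrange : ∀ n k → (n + (k * n + k)) * 2 + 2 ≡ 2 * (suc n * suc k)
  rearrange = solve-∀
... | no ¬fits = code⇒separating K n 3≤n (balance (dense-code n (suc k) 1≤n 64n≤k)) (begin
    (n + (3 * suc k + k)) * 2           ≤⟨ *-monoˡ-≤ 2 (+-mono-≤ n≤k (+-monoʳ-≤ (3 * suc k) (n≤1+n k))) ⟩
    (suc k + (3 * suc k + suc k)) * 2   ≡⟨ rearrange₁ (suc k) ⟩
    10 * suc k                          ≤⟨ small ⟩
    256 * n ^ 2                         ∎) K≡
  where
  open ≤-Reasoning
  rearrange₁ : ∀ k → (k + (3 * k + k)) * 2 ≡ 10 * k
  rearrange₁ = solve-∀
  rearrange₂ : ∀ n → 4 * n * (64 * n) ≡ 256 * (n * (n * 1))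
  rearrange₂ = solve-∀
  rearrange₃ : ∀ n k → 2 * ((n + n) * k) ≡ 4 * n * k
  rearrange₃ = solve-∀
  1≤n : 1 ≤ n
  1≤n = ≤-trans (s≤s z≤n) 3≤n
  4n≢0 : NonZero (4 * n)
  4n≢0 = >-nonZero (*-mono-≤ {1} {4} (s≤s z≤n) 1≤n)
  64n≤k : 64 * n ≤ suc k
  64n≤k = *-cancelˡ-≤ (4 * n) {{4n≢0}} (begin
    4 * n * (64 * n)       ≡⟨ rearrange₂ n ⟩
    256 * n ^ 2            ≤⟨ <⇒≤ (≰⇒> ¬fits) ⟩
    2 * (suc n * suc k)    ≤⟨ *-monoʳ-≤ 2 (*-monoˡ-≤ (suc k) (+-monoˡ-≤ n 1≤n)) ⟩
    2 * ((n + n) * suc k)  ≡⟨ rearrange₃ n (suc k) ⟩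
    4 * n * suc k          ∎)
  n≤k : n ≤ suc k
  n≤k = ≤-trans (m≤m+n n (63 * n)) 64n≤k

eventually : ∀ {K} → K ∈o id → (∀ N → ⌈log₂ N ⌉ ≤ K N) → ∃[ n₀ ] (∀ n → n₀ ≤ n → Separating K n)
-- The argument 9 yields `10 * K N ≤ N`; the summand 3 ensures `3 ≤ n`.
eventually {K} K∈o log≤K with N₀ , K≤ ← K∈o 9 = 3 + N₀ , large
  where
  n≤256n² : ∀ n → 1 ≤ n → n ≤ 256 * n ^ 2
  n≤256n² n 1≤n = begin
    n           ≡⟨ *-identityʳ n ⟨
    n ^ 1       ≤⟨ ^-monoʳ-≤ n {{>-nonZero 1≤n}} {1} {2} (s≤s z≤n) ⟩
    n ^ 2       ≤⟨ m≤n*m (n ^ 2) 256 ⟩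
    256 * n ^ 2 ∎
    where open ≤-Reasoning

  large : ∀ n → 3 + N₀ ≤ n → Separating K n
  -- As `2 ≤ N`, the logarithm is at least 1, so `K N` is a successor.
  large n n₀≤n = positive (≤-trans (⌈log₂⌉-mono-≤ 2≤N) (log≤K N)) refl
    where
    N : ℕ
    N = 256 * n ^ 2
    3≤n : 3 ≤ n
    3≤n = ≤-trans (m≤m+n 3 N₀) n₀≤n
    n≤N : n ≤ N
    n≤N = n≤256n² n (≤-trans (s≤s z≤n) 3≤n)
    2≤N : 2 ≤ N
    2≤N = ≤-trans (≤-trans (s≤s (s≤s z≤n)) 3≤n) n≤N
    positive : ∀ {k} → 1 ≤ k → K N ≡ k → Separating K n
    positive {suc k} _ eq = separating K n 3≤n eq
      (subst (λ k → 10 * k ≤ N) eq (K≤ N (≤-trans (≤-trans (m≤n+m N₀ 3) n₀≤n) n≤N)))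

-- Below the threshold any unsatisfiable formula will do.
choose-formula : ∀ {K n₀} → (∀ n → n₀ ≤ n → Separating K n) →
                 ∀ n → Σ[ Φ ∈ CNF ] Unsatisfiable Φ × (n₀ ≤ n → Σ[ s ∈ Separating K n ] Separating.formula s ≡ Φ)
choose-formula {n₀ = n₀} large n with n₀ ≤? n
... | yes n₀≤n = Separating.formula (large n n₀≤n) , Separating.unsatisfiable (large n n₀≤n) , λ _ → large n n₀≤n , refl
... | no n₀≰n  = record { vars = 0 ; clauses = [ [] ] ; occurs = λ () } , (λ { (_ , () ∷ _) })
                 , λ n₀≤n → contradiction n₀≤n n₀≰n

corollary20 : (k : ℕ → ℕ) → k ∈o id → (∀ N → ⌈log₂ N ⌉ ≤ k N) →
    ExponentiallySeparatedFrom (SR-I (λ N → 2 * k N)) (SRC-II (λ N → 2 * k N ∸ 1))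
corollary20 k k∈o log≤k with n₀ , large ← eventually k∈o log≤k =
  -- The upper bound is `768 * n ^ 2`; below, `d` is 0 because the number of steps is at least
  -- `2 ^ n` itself.
  (λ n → proj₁ (family n)) , (λ n → proj₁ (proj₂ (family n))) , (768 , 2 , n₀ , upper) , (0 , n₀ , lower)
  where
  family = choose-formula large
  upper : ∀ n → n₀ ≤ n → Σ[ π ∈ Refutation (srRule (λ N → 2 * k N)) (proj₁ (family n)) ]
                           suc (length (Refutation.earlier π)) ≤ 768 * n ^ 2
  upper n n₀≤n with Φ , _ , separating ← family n with s , refl ← separating n₀≤n = Separating.upper s
  lower : ∀ n → n₀ ≤ n → (π : Refutation (srcRule (λ N → 2 * k N ∸ 1)) (proj₁ (family n))) →
          2 ^ n ≤ suc (length (Refutation.earlier π)) ^ 1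
  lower n n₀≤n with Φ , _ , separating ← family n with s , refl ← separating n₀≤n =
    λ π → ≤-trans (Separating.lower s π) (≤-reflexive (sym (*-identityʳ _)))
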